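{- The following two statements are equivalent: (a) Every cyclically 4-edge-connected cubic graph $G$ admits a proper $5$-edge-coloring $c$ such that $|N_G(c)|\leq 9$. (b) There exists a sublinear function $f:\mathbb{N}\rightarrow\mathbb{N}$ such that every cyclically 4-edge-connected cubic graph $G$ admits a proper $5$-edge-coloring $c$ with $|N_G(c)|\leq f(|V(G)|)$.
   Context: Graphs are finite, undirected, loopless, and may have parallel edges. A function $f:\mathbb{N}\to\mathbb{N}$ is sublinear if $\lim_{n\to+\infty} f(n)/n=0$. A proper $5$-edge-coloring assigns colors from $\{1,\dots,5\}$ to edges so that adjacent edges get different colors. For an edge-coloring $c$, $S_c(v)$ is the set of colors on edges incident to $v$. An edge $uv$ of a cubic graph is poor if $|S_c(u)\cup S_c(v)|=3$, rich if $|S_c(u)\cup S_c(v)|=5$, and abnormal otherwise. $N_G(c)$ is the set of abnormal edges of $G$ with respect to $c$. -}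

module Defs where

open import Data.Nat using (ℕ; zero; suc; _+_; _*_; _≤_; _≡ᵇ_)
open import Data.Fin using (Fin; zero; suc)
open import Data.Fin.Properties using (_≟_)
open import Data.Bool using (Bool; true; false; _∧_; _∨_; not; _xor_; if_then_else_)
open import Data.Product using (Σ; _×_; _,_; proj₁; proj₂; ∃)
open import Data.Sum using (_⊎_)
open import Relation.Binary.PropositionalEquality using (_≡_; _≢_)
open import Relation.Nullary using (does)

count : ∀ {k} → (Fin k → Bool) → ℕ
count {zero} p = 0
count {suc k} p = (if p zero then 1 else 0) + count (λ i → p (suc i))

anyFin : ∀ {k} → (Fin k → Bool) → Bool
anyFin {zero} p = false
anyFin {suc k} p = p zero ∨ anyFin (λ i → p (suc i))

next : ∀ {k} → Fin (suc k) → Fin (suc k)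
next {zero} _ = zero
next {suc k} zero = suc zero
next {suc k} (suc i) with next {k} i
... | zero = zero
... | suc j = suc (suc j)

record Multigraph : Set where
  field
    n : ℕ
    m : ℕ
    ends : Fin m → Fin n × Fin n
    loopless : ∀ e → proj₁ (ends e) ≢ proj₂ (ends e)

module _ (G : Multigraph) where
  open Multigraph G

  Vertex : Set
  Vertex = Fin n

  Edge : Set
  Edge = Fin m

  incident : Vertex → Edge → Bool
  incident v e = does (v ≟ proj₁ (ends e)) ∨ does (v ≟ proj₂ (ends e))

  degree : Vertex → ℕ
  degree v = count (incident v)

  IsCubic : Set
  IsCubic = ∀ v → degree v ≡ 3

  Joins : Edge → Vertex → Vertex → Set
  Joins e u v = (ends e ≡ (u , v)) ⊎ (ends e ≡ (v , u))

  -- G[X] contains a cycle (length k ≥ 2, so 2-cycles from parallel edges count):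
  -- distinct vertices vs 0..k-1 in X and distinct edges es 0..k-1 with
  -- es i joining vs i and vs (i+1 mod k)
  HasCycleIn : (Vertex → Bool) → Set
  HasCycleIn X =
    Σ ℕ λ j → Σ (Fin (suc (suc j)) → Vertex) λ vs → Σ (Fin (suc (suc j)) → Edge) λ es →
      (∀ i i' → vs i ≡ vs i' → i ≡ i') ×
      (∀ i i' → es i ≡ es i' → i ≡ i') ×
      (∀ i → X (vs i) ≡ true) ×
      (∀ i → Joins (es i) (vs i) (vs (next i)))

  cutSize : (Vertex → Bool) → ℕ
  cutSize X = count (λ e → X (proj₁ (ends e)) xor X (proj₂ (ends e)))

  CyclicallyFourEdgeConnected : Set
  CyclicallyFourEdgeConnected =
    ∀ X → HasCycleIn X → HasCycleIn (λ v → not (X v)) → 4 ≤ cutSize X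

  EdgeColoring5 : Set
  EdgeColoring5 = Edge → Fin 5

  IsProper : EdgeColoring5 → Set
  IsProper c = ∀ e e' → e ≢ e' →
    (Σ Vertex λ v → (incident v e ≡ true) × (incident v e' ≡ true)) → c e ≢ c e'

  unionSize : EdgeColoring5 → Vertex → Vertex → ℕ
  unionSize c u v =
    count {5} (λ k → anyFin (λ e → (incident u e ∨ incident v e) ∧ does (c e ≟ k)))

  -- abnormal: neither poor (3) nor rich (5)
  isAbnormal : EdgeColoring5 → Edge → Bool
  isAbnormal c e =
    let s = unionSize c (proj₁ (ends e)) (proj₂ (ends e))
    in not (s ≡ᵇ 3) ∧ not (s ≡ᵇ 5)

  numAbnormal : EdgeColoring5 → ℕ
  numAbnormal c = count (isAbnormal c)

-- f sublinear: lim f(n)/n = 0, i.e. for every k ≥ 1 eventually f(n)/n ≤ 1/k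
Sublinear : (ℕ → ℕ) → Set
Sublinear f = ∀ k → 1 ≤ k → Σ ℕ λ N → ∀ n → N ≤ n → k * f n ≤ n

StatementA : Set
StatementA = ∀ (G : Multigraph) → IsCubic G → CyclicallyFourEdgeConnected G →
  Σ (EdgeColoring5 G) λ c → IsProper G c × (numAbnormal G c ≤ 9)

StatementB : Set
StatementB = Σ (ℕ → ℕ) λ f → Sublinear f ×
  (∀ (G : Multigraph) → IsCubic G → CyclicallyFourEdgeConnected G →
    Σ (EdgeColoring5 G) λ c → IsProper G c × (numAbnormal G c ≤ f (Multigraph.n G)))

{-# OPTIONS --safe #-}
module Submission where

-- A bound 9 is sublinear.  Conversely, let f be sublinear and let p, q be disjoint edges of G
-- joined by an edge r.  The cyclic cover of G with K sheets in which exactly p and q advance to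
-- the next sheet is again cubic and cyclically 4-edge-connected, so for large K it has a
-- colouring with fewer than K abnormal edges, and some sheet contains none of them.  Pull that
-- sheet back to G and recolour p and q greedily (every edge of a cubic graph has at most 4
-- neighbours).  Only edges meeting p or q can become abnormal; each of p and q meets 5 edges,
-- itself included, and r is counted twice, so there are at most 9.
--
-- For connectivity: in a cubic graph an acyclic set of at least two vertices has a cut of size
-- at least 4, so cyclic 4-edge-connectivity says that every cut with two vertices on each side
-- has size at least 4.  A cut of the cover then costs at least 2 in every sheet that it splits
-- and at least 2 between consecutive unsplit sheets on different sides.

open import Defs
open import Data.Nat using (ℕ; zero; suc; _+_; _*_; _≤_; _<_; z≤n; s≤s; _≤?_; _<?_; _≡ᵇ_; _∸_)
open import Data.Nat.Properties hiding (_≟_)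
open import Data.Nat.Solver using (module +-*-Solver)
open import Data.Fin using (Fin; zero; suc; toℕ; fromℕ; inject₁; inject≤; fromℕ<; combine; remQuot; _↑ˡ_; _↑ʳ_)
open import Data.Fin.Properties
  using (_≟_; any?; pigeonhole; toℕ-injective; toℕ-inject₁; toℕ-fromℕ; toℕ-fromℕ<; toℕ<n; inject≤-injective;
         remQuot-combine; combine-surjective; combine-injective; combine-injectiveˡ; combine-injectiveʳ)
open import Data.Fin.Induction using (<-weakInduction; >-weakInduction)
open import Data.Fin.Relation.Unary.Top using (view; ‵fromℕ; ‵inj₁)
open import Data.Bool using (Bool; true; false; _∧_; _∨_; not; _xor_; if_then_else_)
import Data.Bool.Properties as Bool
open import Data.Product using (Σ; ∃; ∃₂; _×_; _,_; proj₁; proj₂)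
open import Data.Sum using (_⊎_; inj₁; inj₂; [_,_]′) renaming (map to map-⊎)
open import Data.Empty using (⊥; ⊥-elim)
open import Function using (_∘_)
open import Relation.Nullary using (¬_; Dec; yes; no; does)
open import Relation.Nullary.Decidable using (dec-true; dec-false; _×-dec_; ¬?; decidable-stable)
open import Relation.Binary.Definitions using (tri<; tri≈; tri>)
open import Relation.Binary.PropositionalEquality
open import Algebra.Properties.CommutativeMonoid.Sum +-0-commutativeMonoid
  using (sum; sum-cong-≗; sum-replicate-zero; ∑-distrib-+; ∑-comm)
open +-*-Solver using (solve; _:+_; _:=_)

private variable
  k l : ℕ

-- Finite sums, counting and pigeonhole arguments.

⟦_⟧ : Bool → ℕ
⟦ b ⟧ = if b then 1 else 0

⟦⟧≤1 : ∀ b → ⟦ b ⟧ ≤ 1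
⟦⟧≤1 false = z≤n
⟦⟧≤1 true  = ≤-refl

_==_ : Fin k → Fin k → Bool
i == j = does (i ≟ j)

==-true : ∀ {i j : Fin k} → i ≡ j → (i == j) ≡ true
==-true {i = i} {j} = dec-true (i ≟ j)

==-refl : (i : Fin k) → (i == i) ≡ true
==-refl i = ==-true {i = i} refl

==-false : ∀ {i j : Fin k} → i ≢ j → (i == j) ≡ false
==-false {i = i} {j} = dec-false (i ≟ j)

==⇒≡ : ∀ {i j : Fin k} → (i == j) ≡ true → i ≡ j
==⇒≡ {i = i} {j} eq with i ≟ j
... | yes i≡j = i≡j

true≢false : ∀ {b} → b ≡ true → b ≢ false
true≢false refl ()

count≡sum : (p : Fin k → Bool) → count p ≡ sum (λ i → ⟦ p i ⟧)
count≡sum {zero}  p = refl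
count≡sum {suc k} p = cong (⟦ p zero ⟧ +_) (count≡sum (p ∘ suc))

count-cong : {p q : Fin k → Bool} → (∀ i → p i ≡ q i) → count p ≡ count q
count-cong {zero}  p≗q = refl
count-cong {suc k} p≗q = cong₂ _+_ (cong ⟦_⟧ (p≗q zero)) (count-cong (p≗q ∘ suc))

anyFin-true : (p : Fin k → Bool) (i : Fin k) → p i ≡ true → anyFin p ≡ true
anyFin-true p zero    pi rewrite pi = refl
anyFin-true p (suc i) pi rewrite anyFin-true (p ∘ suc) i pi = Bool.∨-zeroʳ (p zero)

anyFin-witness : (p : Fin k → Bool) → anyFin p ≡ true → ∃ λ i → p i ≡ true
anyFin-witness {suc k} p any with p zero in p0
... | true  = zero , p0
... | false with anyFin-witness (p ∘ suc) any
...   | i , pi = suc i , pi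

sum-mono : {f g : Fin k → ℕ} → (∀ i → f i ≤ g i) → sum f ≤ sum g
sum-mono {zero}  f≤g = z≤n
sum-mono {suc k} f≤g = +-mono-≤ (f≤g zero) (sum-mono (f≤g ∘ suc))

term≤sum : (f : Fin k → ℕ) (i : Fin k) → f i ≤ sum f
term≤sum f zero    = m≤m+n _ _
term≤sum f (suc i) = ≤-trans (term≤sum (f ∘ suc) i) (m≤n+m _ _)

two-terms≤sum : (f : Fin k → ℕ) {i j : Fin k} → i ≢ j → f i + f j ≤ sum f
two-terms≤sum f {zero}  {zero}  i≢j = ⊥-elim (i≢j refl)
two-terms≤sum f {zero}  {suc j} i≢j = +-monoʳ-≤ (f zero) (term≤sum (f ∘ suc) j)
two-terms≤sum f {suc i} {zero}  i≢j =
  subst (_≤ sum f) (+-comm (f zero) (f (suc i))) (+-monoʳ-≤ (f zero) (term≤sum (f ∘ suc) i))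
two-terms≤sum f {suc i} {suc j} i≢j =
  ≤-trans (two-terms≤sum (f ∘ suc) (i≢j ∘ cong suc)) (m≤n+m _ _)

sum-indicator : (i : Fin k) (f : Fin k → ℕ) → sum (λ j → if i == j then f j else 0) ≡ f i
sum-indicator {suc k} zero f = trans (cong (f zero +_) (sum-replicate-zero k)) (+-identityʳ _)
sum-indicator (suc i) f = sum-indicator i (f ∘ suc)

sum-== : (i : Fin k) → sum (λ j → ⟦ i == j ⟧) ≡ 1
sum-== i = sum-indicator i (λ _ → 1)

sum-const : ∀ k x → sum {k} (λ _ → x) ≡ k * x
sum-const zero    x = refl
sum-const (suc k) x = cong (x +_) (sum-const k x)

sum-++ : (f : Fin (k + l) → ℕ) → sum f ≡ sum (λ i → f (i ↑ˡ l)) + sum (λ j → f (k ↑ʳ j))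
sum-++ {zero}  f = refl
sum-++ {suc k} f = trans (cong (f zero +_) (sum-++ {k} (f ∘ suc))) (sym (+-assoc (f zero) _ _))

sum-combine : (f : Fin (k * l) → ℕ) → sum f ≡ sum (λ (i : Fin k) → sum (λ (j : Fin l) → f (combine i j)))
sum-combine {zero}      f = refl
sum-combine {suc k} {l} f =
  trans (sum-++ {l} f) (cong (sum (λ j → f (j ↑ˡ (k * l))) +_) (sum-combine {k} {l} (λ x → f (l ↑ʳ x))))

sum<size⇒zero : (f : Fin k → ℕ) → sum f < k → ∃ λ i → f i ≡ 0
sum<size⇒zero {suc k} f (s≤s sum≤k) with f zero in f0
... | zero  = zero , f0
... | suc x with sum<size⇒zero (f ∘ suc) (≤-trans (s≤s (m≤n+m _ x)) sum≤k)
...   | i , fi≡0 = suc i , fi≡0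

sum⟦⟧≥1⇒∃ : (p : Fin k → Bool) → 1 ≤ sum (λ i → ⟦ p i ⟧) → ∃ λ i → p i ≡ true
sum⟦⟧≥1⇒∃ {suc k} p 1≤ with p zero in p0
... | true  = zero , p0
... | false with sum⟦⟧≥1⇒∃ (p ∘ suc) 1≤
...   | i , pi = suc i , pi

sum⟦⟧≥2⇒∃₂ : (p : Fin k → Bool) → 2 ≤ sum (λ i → ⟦ p i ⟧) →
  ∃₂ λ i j → i ≢ j × p i ≡ true × p j ≡ true
sum⟦⟧≥2⇒∃₂ {suc k} p 2≤ with p zero in p0
... | true with sum⟦⟧≥1⇒∃ (p ∘ suc) (≤-pred 2≤)
...   | j , pj = zero , suc j , (λ ()) , p0 , pj
sum⟦⟧≥2⇒∃₂ {suc k} p 2≤ | false with sum⟦⟧≥2⇒∃₂ (p ∘ suc) 2≤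
...   | i , j , i≢j , pi , pj = suc i , suc j , (λ { refl → i≢j refl }) , pi , pj

avoid : (p : Fin k → Bool) → 2 ≤ sum (λ i → ⟦ p i ⟧) → ∀ i → ∃ λ j → j ≢ i × p j ≡ true
avoid p 2≤ i with sum⟦⟧≥2⇒∃₂ p 2≤
... | a , b , a≢b , pa , pb with a ≟ i
...   | no  a≢i = a , a≢i , pa
...   | yes refl = b , (λ b≡a → a≢b (sym b≡a)) , pb

sum-split-two : {p q : Fin k} → p ≢ q → (f : Fin k → ℕ) →
  sum f ≡ sum (λ i → if (p == i) ∨ (q == i) then 0 else f i) + (f p + f q)
sum-split-two {p = p} {q} p≢q f = begin
  sum f
    ≡⟨ sum-cong-≗ pointwise ⟩
  sum (λ i → rest i + (at p i + at q i))
    ≡⟨ ∑-distrib-+ rest _ ⟩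
  sum rest + sum (λ i → at p i + at q i)
    ≡⟨ cong (sum rest +_) (trans (∑-distrib-+ (at p) (at q)) (cong₂ _+_ (sum-indicator p f) (sum-indicator q f))) ⟩
  sum rest + (f p + f q) ∎
  where
  open ≡-Reasoning
  rest = λ i → if (p == i) ∨ (q == i) then 0 else f i
  at = λ j i → if j == i then f i else 0
  pointwise : ∀ i → f i ≡ rest i + (at p i + at q i)
  pointwise i with p ≟ i | q ≟ i
  ... | yes refl | yes refl = ⊥-elim (p≢q refl)
  ... | yes _    | no _     = sym (+-identityʳ _)
  ... | no _     | yes _    = refl
  ... | no _     | no _     = sym (+-identityʳ _)

-- Double counting: over all values, the numbers of indices in `S` taking that value add up to the
-- size of `S`, which is below `l`, so one of these numbers is zero.
free-value : (c : Fin k → Fin l) (S : Fin k → Bool) → sum (λ i → ⟦ S i ⟧) < l →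
  ∃ λ x → ∀ i → S i ≡ true → c i ≢ x
free-value {k} {l} c S |S|<l =
  let x , none = sum<size⇒zero uses (subst (_< l) (sym total) |S|<l)
  in  x , λ i Si ci≡x → 1+n≰n (subst₂ _≤_ (one i Si ci≡x) none (term≤sum (λ i → hit i x) i))
  where
  hit : Fin k → Fin l → ℕ
  hit i x = if c i == x then ⟦ S i ⟧ else 0
  uses : Fin l → ℕ
  uses x = sum (λ i → hit i x)
  total : sum uses ≡ sum (λ i → ⟦ S i ⟧)
  total = trans (∑-comm (λ x i → hit i x)) (sum-cong-≗ (λ i → sum-indicator (c i) (λ _ → ⟦ S i ⟧)))
  one : ∀ i {x} → S i ≡ true → c i ≡ x → hit i x ≡ 1
  one i Si ci≡x rewrite ==-true ci≡x | Si = refl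

-- The cyclic successor and Boolean labels around a cycle.

next-inject₁ : (i : Fin k) → next (inject₁ i) ≡ suc i
next-inject₁ zero    = refl
next-inject₁ (suc i) rewrite next-inject₁ i = refl

next-fromℕ : ∀ k → next (fromℕ k) ≡ zero
next-fromℕ zero    = refl
next-fromℕ (suc k) rewrite next-fromℕ k = refl

prev : Fin (suc k) → Fin (suc k)
prev zero    = fromℕ _
prev (suc i) = inject₁ i

next-prev : (i : Fin (suc k)) → next (prev i) ≡ i
next-prev zero    = next-fromℕ _
next-prev (suc i) = next-inject₁ i

prev-next : (i : Fin (suc k)) → prev (next i) ≡ i
prev-next i with view i
... | ‵fromℕ     = cong prev (next-fromℕ _)
... | ‵inj₁ {i = j} _ = cong prev (next-inject₁ j)

next≢ : (i : Fin (suc (suc k))) → next i ≢ i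
next≢ i eq with view i
next≢ {k} _ eq | ‵fromℕ with trans (sym (next-fromℕ (suc k))) eq
... | ()
next≢ _ eq | ‵inj₁ {i = j} _ = 1+n≢n (trans (cong toℕ (trans (sym (next-inject₁ j)) eq)) (toℕ-inject₁ j))

-- Steps of `next` climb from `i` to the last element, wrap around to `zero`, and from `zero` reach
-- everything.
next-closed⇒full : (P : Fin (suc k) → Set) → (∀ i → P i → P (next i)) → ∀ i → P i → ∀ j → P j
next-closed⇒full {k} P closed i Pi = <-weakInduction P P-zero step
  where
  step : ∀ j → P (inject₁ j) → P (suc j)
  step j = subst P (next-inject₁ j) ∘ closed (inject₁ j)
  P-last : P (fromℕ k)
  P-last = >-weakInduction (λ j → P j → P (fromℕ k)) (λ Pj → Pj) (λ j P-after → P-after ∘ step j) i Pi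
  P-zero : P zero
  P-zero = subst P (next-fromℕ k) (closed (fromℕ k) P-last)

-- Without a step from `β` to `not β`, the places with value `β` are closed under `next`, so they
-- are all places or none.
no-change⇒constant : (h : Fin (suc k) → Bool) (β : Bool) →
  ¬ (∃ λ s → h s ≡ β × h (next s) ≡ not β) → ∃ λ γ → ∀ i → h i ≡ γ
no-change⇒constant h β none with any? (λ i → h i Bool.≟ β)
... | yes (i , hi≡β) = β , next-closed⇒full (λ j → h j ≡ β) closed i hi≡β
  where
  closed : ∀ j → h j ≡ β → h (next j) ≡ β
  closed j hj≡β = trans (Bool.¬-not (λ eq → none (j , hj≡β , eq))) (Bool.not-involutive β)
... | no  avoids     = not β , λ i → Bool.¬-not (λ eq → avoids (i , eq))

constant-or-changes : (h : Fin (suc k) → Bool) →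
  (∃ λ γ → ∀ i → h i ≡ γ) ⊎
  (∃₂ λ s t → (h s ≡ true × h (next s) ≡ false) × (h t ≡ false × h (next t) ≡ true))
constant-or-changes h with change? true | change? false
  where
  change? : ∀ β → Dec (∃ λ s → h s ≡ β × h (next s) ≡ not β)
  change? β = any? (λ s → (h s Bool.≟ β) ×-dec (h (next s) Bool.≟ not β))
... | yes (s , down) | yes (t , up) = inj₂ (s , t , down , up)
... | no none        | _            = inj₁ (no-change⇒constant h true none)
... | _              | no none      = inj₁ (no-change⇒constant h false none)

-- Boolean identities.

==-sym : (i j : Fin k) → (i == j) ≡ (j == i)
==-sym i j with i ≟ j
... | yes i≡j = sym (==-true (sym i≡j))
... | no  i≢j = sym (==-false (i≢j ∘ sym))

xor-both : ∀ a b β → (a xor β) xor (b xor β) ≡ a xor b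
xor-both false false false = refl
xor-both false false true  = refl
xor-both false true  false = refl
xor-both false true  true  = refl
xor-both true  false false = refl
xor-both true  false true  = refl
xor-both true  true  false = refl
xor-both true  true  true  = refl

⟦∨⟧-disjoint : ∀ a b → a ∧ b ≡ false → ⟦ a ∨ b ⟧ ≡ ⟦ a ⟧ + ⟦ b ⟧
⟦∨⟧-disjoint false _     _ = refl
⟦∨⟧-disjoint true  false _ = refl

xor-disjoint : ∀ a b → a ∧ b ≡ false → a xor b ≡ a ∨ b
xor-disjoint false _     _ = refl
xor-disjoint true  false _ = refl

∧-true : ∀ a b → a ∧ b ≡ true → a ≡ true × b ≡ true
∧-true true true _ = refl , refl

∨-intro : ∀ a b → a ≡ true ⊎ b ≡ true → a ∨ b ≡ true
∨-intro true  _ _          = refl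
∨-intro false _ (inj₂ b≡t) = b≡t

∨-true : ∀ a b → a ∨ b ≡ true → a ≡ true ⊎ b ≡ true
∨-true true  _ _  = inj₁ refl
∨-true false _ eq = inj₂ eq

∨-false : ∀ a b → a ∨ b ≡ false → a ≡ false × b ≡ false
∨-false false _ eq = refl , eq

≡true-iff : ∀ {a b} → (a ≡ true → b ≡ true) → (b ≡ true → a ≡ true) → a ≡ b
≡true-iff {true}  {true}  _ _ = refl
≡true-iff {true}  {false} f _ = sym (f refl)
≡true-iff {false} {true}  _ g = g refl
≡true-iff {false} {false} _ _ = refl

-- Incidence and cuts in multigraphs.

module Graph (G : Multigraph) where
  open Multigraph G

  src tgt : Fin m → Fin n
  src e = proj₁ (ends e)
  tgt e = proj₂ (ends e)

  Inc : Fin n → Fin m → Set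
  Inc v e = incident G v e ≡ true

  cut : (Fin n → Bool) → Fin m → Bool
  cut A e = A (src e) xor A (tgt e)

  Inc-src : ∀ e → Inc (src e) e
  Inc-src e rewrite ==-true {i = src e} refl = refl

  Inc-tgt : ∀ e → Inc (tgt e) e
  Inc-tgt e rewrite ==-true {i = tgt e} refl = Bool.∨-zeroʳ (tgt e == src e)

  Inc⇒end : ∀ v e → Inc v e → v ≡ src e ⊎ v ≡ tgt e
  Inc⇒end v e inc with v ≟ src e
  ... | yes v≡src = inj₁ v≡src
  ... | no  _     = inj₂ (==⇒≡ inc)

  ends-disjoint : ∀ v e → (v == src e) ∧ (v == tgt e) ≡ false
  ends-disjoint v e with v ≟ src e | v ≟ tgt e
  ... | yes v≡src | yes v≡tgt = ⊥-elim (loopless e (trans (sym v≡src) v≡tgt))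
  ... | yes _     | no  _     = refl
  ... | no  _     | _         = refl

  incident-split : ∀ v e → ⟦ incident G v e ⟧ ≡ ⟦ v == src e ⟧ + ⟦ v == tgt e ⟧
  incident-split v e = ⟦∨⟧-disjoint (v == src e) (v == tgt e) (ends-disjoint v e)

  sum-incident : ∀ e → sum (λ v → ⟦ incident G v e ⟧) ≡ 2
  sum-incident e = begin
    sum (λ v → ⟦ incident G v e ⟧)
      ≡⟨ sum-cong-≗ (λ v → trans (incident-split v e)
           (cong₂ _+_ (cong ⟦_⟧ (==-sym v (src e))) (cong ⟦_⟧ (==-sym v (tgt e))))) ⟩
    sum (λ v → ⟦ src e == v ⟧ + ⟦ tgt e == v ⟧)
      ≡⟨ ∑-distrib-+ (λ v → ⟦ src e == v ⟧) (λ v → ⟦ tgt e == v ⟧) ⟩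
    sum (λ v → ⟦ src e == v ⟧) + sum (λ v → ⟦ tgt e == v ⟧)
      ≡⟨ cong₂ _+_ (sum-== (src e)) (sum-== (tgt e)) ⟩
    2 ∎
    where open ≡-Reasoning

  cutSize≡sum : ∀ A → cutSize G A ≡ sum (λ e → ⟦ cut A e ⟧)
  cutSize≡sum A = count≡sum (cut A)

  -- `_xor β` keeps or complements a set according to `β`, so both sides of a cut can be treated by
  -- one argument.
  cut-xor : ∀ A β e → cut (λ v → A v xor β) e ≡ cut A e
  cut-xor A β e = xor-both (A (src e)) (A (tgt e)) β

  cutSize-xor : ∀ A β → cutSize G (λ v → A v xor β) ≡ cutSize G A
  cutSize-xor A β = count-cong (cut-xor A β)

  cut-cong : ∀ {A B} → (∀ v → A v ≡ B v) → ∀ e → cut A e ≡ cut B e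
  cut-cong A≗B e = cong₂ _xor_ (A≗B (src e)) (A≗B (tgt e))

  other : Fin n → Fin m → Fin n
  other v e = if v == src e then tgt e else src e

  joins-other : ∀ v e → Inc v e → Joins G e v (other v e)
  joins-other v e inc with v ≟ src e
  ... | yes refl = inj₁ refl
  ... | no  _    = inj₂ (cong (src e ,_) (sym (==⇒≡ inc)))

  Joins⇒Inc : ∀ {e u v} → Joins G e u v → Inc u e × Inc v e
  Joins⇒Inc {e} (inj₁ eq) =
    subst (λ uv → Inc (proj₁ uv) e × Inc (proj₂ uv) e) eq (Inc-src e , Inc-tgt e)
  Joins⇒Inc {e} (inj₂ eq) =
    subst (λ vu → Inc (proj₂ vu) e × Inc (proj₁ vu) e) eq (Inc-tgt e , Inc-src e)

  Joins⇒≢ : ∀ {e u v} → Joins G e u v → u ≢ v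
  Joins⇒≢ {e} (inj₁ eq) u≡v = loopless e (trans (cong proj₁ eq) (trans u≡v (sym (cong proj₂ eq))))
  Joins⇒≢ {e} (inj₂ eq) u≡v = loopless e (trans (cong proj₁ eq) (trans (sym u≡v) (sym (cong proj₂ eq))))

  Joins-unique : ∀ {e u v x y} → Joins G e u v → Joins G e x y → u ≡ x ⊎ v ≡ x
  Joins-unique (inj₁ p) (inj₁ q) = inj₁ (cong proj₁ (trans (sym p) q))
  Joins-unique (inj₁ p) (inj₂ q) = inj₂ (cong proj₂ (trans (sym p) q))
  Joins-unique (inj₂ p) (inj₁ q) = inj₂ (cong proj₁ (trans (sym p) q))
  Joins-unique (inj₂ p) (inj₂ q) = inj₁ (cong proj₂ (trans (sym p) q))

  Joins-end : ∀ e y {u w} → Joins G e u w → Inc y e → y ≡ u ⊎ y ≡ w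
  Joins-end e y (inj₁ eq) inc with Inc⇒end y e inc
  ... | inj₁ y≡s = inj₁ (trans y≡s (cong proj₁ eq))
  ... | inj₂ y≡t = inj₂ (trans y≡t (cong proj₂ eq))
  Joins-end e y (inj₂ eq) inc with Inc⇒end y e inc
  ... | inj₁ y≡s = inj₂ (trans y≡s (cong proj₁ eq))
  ... | inj₂ y≡t = inj₁ (trans y≡t (cong proj₂ eq))

  -- Propositional form of the test counted by `unionSize`; it allows colour sets in `G` and in its
  -- cover to be compared edge by edge.
  Seen : EdgeColoring5 G → Fin n → Fin n → Fin 5 → Set
  Seen c x y a = ∃ λ e → (Inc x e ⊎ Inc y e) × c e ≡ a

  seen⇒ : ∀ c x y a → anyFin (λ e → (incident G x e ∨ incident G y e) ∧ (c e == a)) ≡ true → Seen c x y a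
  seen⇒ c x y a any =
    let e , e-sees = anyFin-witness (λ e → (incident G x e ∨ incident G y e) ∧ (c e == a)) any
        xy∈e , ce==a = ∧-true (incident G x e ∨ incident G y e) (c e == a) e-sees
    in  e , ∨-true (incident G x e) (incident G y e) xy∈e , ==⇒≡ ce==a

  seen⇐ : ∀ c x y a → Seen c x y a → anyFin (λ e → (incident G x e ∨ incident G y e) ∧ (c e == a)) ≡ true
  seen⇐ c x y a (e , inc , ce≡a) = anyFin-true _ e
    (cong₂ _∧_ (∨-intro (incident G x e) (incident G y e) inc) (==-true ce≡a))

-- Cycles from non-backtracking walks.

private
  Distinct : (ℕ → Fin k) → ℕ → ℕ → Set
  Distinct w i j = ∀ a b → a < b → b ≤ j → w (i + a) ≢ w (i + b)

  -- A repetition among the positions `i` to `i + k` is a return over a shorter gap, from which the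
  -- search restarts. `bound` dominates the gap and makes the recursion structural.
  shortest-return : (w : ℕ → Fin l) → ∀ bound k → k ≤ bound → ∀ i → w i ≡ w (i + suc k) →
    ∃₂ λ i k → w i ≡ w (i + suc k) × Distinct w i k
  shortest-return w bound k k≤bound i ret
    with any? (λ a → any? (λ b → (toℕ {suc k} a <? toℕ {suc k} b) ×-dec (w (i + toℕ a) ≟ w (i + toℕ b))))
  shortest-return w zero    zero z≤n _ _ | yes (zero , zero , () , _)
  shortest-return w (suc bound) k k≤bound i ret | yes (a , b , a<b , eq) =
    shortest-return w bound (toℕ b ∸ suc (toℕ a)) shorter (i + toℕ a)
      (trans eq (cong w (sym (trans (+-assoc i (toℕ a) _) (cong (i +_) gap)))))
    where
    gap : toℕ a + suc (toℕ b ∸ suc (toℕ a)) ≡ toℕ b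
    gap = trans (+-suc (toℕ a) _) (m+[n∸m]≡n a<b)
    shorter : toℕ b ∸ suc (toℕ a) ≤ bound
    shorter = ≤-trans (∸-monoʳ-≤ (toℕ b) (s≤s z≤n)) (∸-monoˡ-≤ 1 (≤-trans (≤-pred (toℕ<n b)) k≤bound))
  ... | no distinct = i , k , ret , λ a b a<b b≤k eq →
    let a<1+k = s≤s (≤-trans (<⇒≤ a<b) b≤k)
        b<1+k = s≤s b≤k
        toℕ-a = toℕ-fromℕ< a<1+k
        toℕ-b = toℕ-fromℕ< b<1+k
    in  distinct (fromℕ< a<1+k , fromℕ< b<1+k , subst₂ _<_ (sym toℕ-a) (sym toℕ-b) a<b ,
          subst₂ (λ a b → w (i + a) ≡ w (i + b)) (sym toℕ-a) (sym toℕ-b) eq)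

  returns : (w : ℕ → Fin k) → ∃₂ λ i d → w i ≡ w (i + suc d)
  returns {k} w with pigeonhole (n<1+n k) (w ∘ toℕ)
  ... | i , j , i<j , eq = toℕ i , toℕ j ∸ suc (toℕ i) ,
    trans eq (cong w (sym (trans (+-suc (toℕ i) _) (m+[n∸m]≡n i<j))))

module Cycles (G : Multigraph) (A : Vertex G → Bool) where
  open Multigraph G
  open Graph G

  -- The first return of a non-backtracking walk to an earlier vertex closes a cycle.
  walk⇒cycle : (w : ℕ → Vertex G) (s : ℕ → Edge G) → (∀ t → A (w t) ≡ true) →
    (∀ t → Joins G (s t) (w t) (w (suc t))) → (∀ t → s t ≢ s (suc t)) → HasCycleIn G A
  walk⇒cycle w s w∈A joins turns with returns w
  ... | i₀ , d₀ , ret₀ with shortest-return w d₀ d₀ ≤-refl i₀ ret₀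
  -- A return after one step would be a loop. In the other case the cycle has length `j + 2`, as
  -- indexed by `HasCycleIn`.
  ...   | i , zero  , ret , _        =
    ⊥-elim (Joins⇒≢ (joins i) (trans ret (cong w (+-comm i 1))))
  ...   | i , suc j , ret , distinct =
    j , vs , es , injective vs vs-< , injective es es-< , (λ t → w∈A _) , es-join
    where
    vs : Fin (suc (suc j)) → Vertex G
    vs t = w (i + toℕ t)
    es : Fin (suc (suc j)) → Edge G
    es t = s (i + toℕ t)
    toℕ≤ : (t : Fin (suc (suc j))) → toℕ t ≤ suc j
    toℕ≤ t = ≤-pred (toℕ<n t)
    injective : {B : Set} (f : Fin (suc (suc j)) → B) → (∀ a b → toℕ a < toℕ b → f a ≢ f b) →
      ∀ a b → f a ≡ f b → a ≡ b
    injective f f-< a b eq with <-cmp (toℕ a) (toℕ b)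
    ... | tri< a<b _ _ = ⊥-elim (f-< a b a<b eq)
    ... | tri≈ _ a≡b _ = toℕ-injective a≡b
    ... | tri> _ _ b<a = ⊥-elim (f-< b a b<a (sym eq))
    vs-< : ∀ a b → toℕ a < toℕ b → vs a ≢ vs b
    vs-< a b a<b = distinct (toℕ a) (toℕ b) a<b (toℕ≤ b)
    es-< : ∀ a b → toℕ a < toℕ b → es a ≢ es b
    -- If the edges at times a < b agree, then `vs b` is `vs a` or the vertex following it.
    -- Distinctness allows only the latter with b = a + 1, and then the walk would backtrack.
    es-< a b a<b eq
      with Joins-unique (joins (i + toℕ a)) (subst (λ e → Joins G e _ _) (sym eq) (joins (i + toℕ b)))
    ... | inj₁ wa≡wb = vs-< a b a<b wa≡wb
    ... | inj₂ wa′≡wb with m≤n⇒m<n∨m≡n a<b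
    ...   | inj₁ a′<b = distinct (suc (toℕ a)) (toℕ b) a′<b (toℕ≤ b) (trans (cong w (+-suc i _)) wa′≡wb)
    ...   | inj₂ a′≡b = turns (i + toℕ a) (trans eq (cong s (trans (cong (i +_) (sym a′≡b)) (+-suc i _))))
    es-join : ∀ t → Joins G (es t) (vs t) (vs (next t))
    es-join t = subst (Joins G (es t) (vs t)) (next-vertex t) (joins (i + toℕ t))
      where
      next-vertex : ∀ t → w (suc (i + toℕ t)) ≡ vs (next t)
      next-vertex t with view t
      ... | ‵inj₁ {i = u} _ = cong w (trans (sym (+-suc i _))
        (cong (i +_) (trans (cong suc (toℕ-inject₁ u)) (cong toℕ (sym (next-inject₁ u))))))
      ... | ‵fromℕ = begin
        w (suc (i + toℕ (fromℕ (suc j)))) ≡⟨ cong (λ x → w (suc (i + x))) (toℕ-fromℕ (suc j)) ⟩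
        w (suc (i + suc j))               ≡⟨ cong w (+-suc i (suc j)) ⟨
        w (i + suc (suc j))               ≡⟨ ret ⟨
        w i                               ≡⟨ cong w (+-identityʳ i) ⟨
        w (i + 0)                         ≡⟨ cong vs (next-fromℕ (suc j)) ⟨
        vs (next (fromℕ (suc j)))         ∎
        where open ≡-Reasoning

  inner : Vertex G → Edge G → Bool
  inner v e = incident G v e ∧ (A (src e) ∧ A (tgt e))

  -- For `v` in `A` this is the degree of `v` in the subgraph induced by `A`.
  innerDegree : Vertex G → ℕ
  innerDegree v = sum (λ e → ⟦ inner v e ⟧)

  inner-incident : ∀ v e → inner v e ≡ true → Inc v e
  inner-incident v e inn = proj₁ (∧-true (incident G v e) _ inn)

  inner-other : ∀ v e → inner v e ≡ true → A (other v e) ≡ true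
  inner-other v e inn with ∧-true (incident G v e) _ inn
  ... | _ , both with ∧-true (A (src e)) _ both
  ...   | As , At with v ≟ src e
  ...     | yes _ = At
  ...     | no  _ = As

  -- At every vertex reached there is an inner edge other than the edge of arrival, so a walk inside
  -- `A` continues forever without backtracking.
  innerDegree≥2⇒cycle : (∀ v → A v ≡ true → 2 ≤ innerDegree v) → ∀ v → A v ≡ true → HasCycleIn G A
  innerDegree≥2⇒cycle deg≥2 v₀ v₀∈A =
    walk⇒cycle (proj₁ ∘ state) (edge ∘ state) (in-A ∘ state)
      (joins ∘ state)
      (λ t eq → proj₁ (proj₂ (onward (state t))) (sym eq))
    where
    -- A state holds the current vertex and the inner edge by which the walk is about to leave it.
    State : Set
    State = ∃₂ λ v e → A v ≡ true × inner v e ≡ true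
    edge : State → Edge G
    edge (_ , e , _) = e
    in-A : (z : State) → A (proj₁ z) ≡ true
    in-A (_ , _ , v∈A , _) = v∈A
    leaves : (z : State) → inner (proj₁ z) (edge z) ≡ true
    leaves (_ , _ , _ , inn) = inn
    joins : (z : State) → Joins G (edge z) (proj₁ z) (other (proj₁ z) (edge z))
    joins z = joins-other (proj₁ z) (edge z) (inner-incident (proj₁ z) (edge z) (leaves z))
    head : State → Vertex G
    head (v , e , _) = other v e
    onward : (z : State) → ∃ λ e → e ≢ edge z × inner (head z) e ≡ true
    onward z = avoid (inner (head z)) (deg≥2 (head z) (inner-other (proj₁ z) (edge z) (leaves z))) (edge z)
    step : State → State
    step z = head z , proj₁ (onward z) , inner-other (proj₁ z) (edge z) (leaves z) , proj₂ (proj₂ (onward z))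
    start : State
    start with sum⟦⟧≥1⇒∃ (inner v₀) (≤-trans (s≤s z≤n) (deg≥2 v₀ v₀∈A))
    ... | e , inn = v₀ , e , v₀∈A , inn
    state : ℕ → State
    state zero    = start
    state (suc t) = step (state t)

-- Cut sizes in cubic graphs under removal of a vertex.

-- The effect on one edge of removing a vertex v of A: `p`, `q` say that v is the source or target,
-- `a`, `b` that the source or target lies in A. An edge at v either leaves the cut, or was inner
-- and enters it; all other edges keep their status.
leaf-identity : ∀ p q a b → p ∧ q ≡ false → (p ≡ true → a ≡ true) → (q ≡ true → b ≡ true) →
  ⟦ a xor b ⟧ + (⟦ (p ∨ q) ∧ (a ∧ b) ⟧ + ⟦ (p ∨ q) ∧ (a ∧ b) ⟧) ≡
  ⟦ (a ∧ not p) xor (b ∧ not q) ⟧ + ⟦ p ∨ q ⟧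
leaf-identity true  true  _     _     () _ _
leaf-identity true  false false _     _ p⇒a _ with p⇒a refl
... | ()
leaf-identity true  false true  false _ _ _ = refl
leaf-identity true  false true  true  _ _ _ = refl
leaf-identity false true  _     false _ _ q⇒b with q⇒b refl
... | ()
leaf-identity false true  false true  _ _ _ = refl
leaf-identity false true  true  true  _ _ _ = refl
leaf-identity false false false false _ _ _ = refl
leaf-identity false false false true  _ _ _ = refl
leaf-identity false false true  false _ _ _ = refl
leaf-identity false false true  true  _ _ _ = refl

remove : Fin k → (Fin k → Bool) → Fin k → Bool
remove v A x = A x ∧ not (v == x)

remove-≢ : ∀ {v w : Fin k} A → v ≢ w → A w ≡ true → remove v A w ≡ true
remove-≢ A v≢w w∈A rewrite w∈A | ==-false v≢w = refl

remove⇒ : ∀ (v : Fin k) A x → remove v A x ≡ true → A x ≡ true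
remove⇒ v A x x∈ = proj₁ (∧-true (A x) _ x∈)

sum-remove-< : ∀ {v : Fin k} A → A v ≡ true →
  sum (λ x → ⟦ remove v A x ⟧) + 1 ≡ sum (λ x → ⟦ A x ⟧)
sum-remove-< {v = v} A v∈A = begin
  sum (λ x → ⟦ remove v A x ⟧) + 1
    ≡⟨ cong (sum (λ x → ⟦ remove v A x ⟧) +_) (sum-== v) ⟨
  sum (λ x → ⟦ remove v A x ⟧) + sum (λ x → ⟦ v == x ⟧)
    ≡⟨ ∑-distrib-+ (λ x → ⟦ remove v A x ⟧) (λ x → ⟦ v == x ⟧) ⟨
  sum (λ x → ⟦ remove v A x ⟧ + ⟦ v == x ⟧)
    ≡⟨ sum-cong-≗ pointwise ⟩
  sum (λ x → ⟦ A x ⟧) ∎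
  where
  open ≡-Reasoning
  pointwise : ∀ x → ⟦ remove v A x ⟧ + ⟦ v == x ⟧ ≡ ⟦ A x ⟧
  pointwise x with v ≟ x | A x in Ax
  ... | yes refl | true  = refl
  ... | yes refl | false = ⊥-elim (true≢false v∈A Ax)
  ... | no  _    | true  = refl
  ... | no  _    | false = refl

HasCycleIn-mono : ∀ {G A B} → (∀ v → A v ≡ true → B v ≡ true) → HasCycleIn G A → HasCycleIn G B
HasCycleIn-mono A⊆B (j , vs , es , vs-inj , es-inj , vs∈A , joins) =
  j , vs , es , vs-inj , es-inj , (λ i → A⊆B (vs i) (vs∈A i)) , joins

module Cubic (G : Multigraph) (cubic : IsCubic G) where
  open Multigraph G
  open Graph G
  open Cycles G

  sum-degree : ∀ v → sum (λ e → ⟦ incident G v e ⟧) ≡ 3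
  sum-degree v = trans (sym (count≡sum (incident G v))) (cubic v)

  handshake : n * 3 ≡ m * 2
  handshake = begin
    n * 3                                          ≡⟨ sum-const n 3 ⟨
    sum {n} (λ _ → 3)                              ≡⟨ sum-cong-≗ sum-degree ⟨
    sum (λ v → sum (λ e → ⟦ incident G v e ⟧))     ≡⟨ ∑-comm (λ v e → ⟦ incident G v e ⟧) ⟩
    sum (λ e → sum (λ v → ⟦ incident G v e ⟧))     ≡⟨ sum-cong-≗ sum-incident ⟩
    sum {m} (λ _ → 2)                              ≡⟨ sum-const m 2 ⟩
    m * 2                                          ∎
    where open ≡-Reasoning

  cut-singleton : ∀ A x → A x ≡ true → (∀ y → x ≢ y → A y ≡ false) → ∀ e → cut A e ≡ incident G x e
  cut-singleton A x x∈A only e =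
    trans (cut-cong A≗x e) (xor-disjoint (x == src e) (x == tgt e) (ends-disjoint x e))
    where
    A≗x : ∀ y → A y ≡ (x == y)
    A≗x y with x ≟ y
    ... | yes refl = x∈A
    ... | no  x≢y  = only y x≢y

  cutSize-singleton : ∀ A x → A x ≡ true → (∀ y → x ≢ y → A y ≡ false) → cutSize G A ≡ 3
  cutSize-singleton A x x∈A only = trans (count-cong (cut-singleton A x x∈A only)) (cubic x)

  -- This is `leaf-identity` summed over all edges; the 3 is the degree of `v`.
  cutSize-remove : ∀ A v → A v ≡ true →
    cutSize G A + (innerDegree A v + innerDegree A v) ≡ cutSize G (remove v A) + 3
  cutSize-remove A v v∈A = begin
    cutSize G A + (innerDegree A v + innerDegree A v)
      ≡⟨ cong₂ _+_ (cutSize≡sum A) (sym (∑-distrib-+ (λ e → ⟦ inner A v e ⟧) (λ e → ⟦ inner A v e ⟧))) ⟩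
    sum (λ e → ⟦ cut A e ⟧) + sum (λ e → ⟦ inner A v e ⟧ + ⟦ inner A v e ⟧)
      ≡⟨ ∑-distrib-+ (λ e → ⟦ cut A e ⟧) (λ e → ⟦ inner A v e ⟧ + ⟦ inner A v e ⟧) ⟨
    sum (λ e → ⟦ cut A e ⟧ + (⟦ inner A v e ⟧ + ⟦ inner A v e ⟧))
      ≡⟨ sum-cong-≗ (λ e → leaf-identity (v == src e) (v == tgt e) (A (src e)) (A (tgt e)) (ends-disjoint v e) v⇒∈ v⇒∈) ⟩
    sum (λ e → ⟦ cut (remove v A) e ⟧ + ⟦ incident G v e ⟧)
      ≡⟨ ∑-distrib-+ (λ e → ⟦ cut (remove v A) e ⟧) (λ e → ⟦ incident G v e ⟧) ⟩
    sum (λ e → ⟦ cut (remove v A) e ⟧) + sum (λ e → ⟦ incident G v e ⟧)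
      ≡⟨ cong₂ _+_ (sym (cutSize≡sum (remove v A))) (sum-degree v) ⟩
    cutSize G (remove v A) + 3 ∎
    where
    open ≡-Reasoning
    v⇒∈ : ∀ {x} → (v == x) ≡ true → A x ≡ true
    v⇒∈ v==x = subst (λ x → A x ≡ true) (==⇒≡ v==x) v∈A

  -- At least two of the three edges at `v` leave the cut and at most one enters it.
  cutSize-leaf : ∀ A v → A v ≡ true → innerDegree A v ≤ 1 → cutSize G (remove v A) < cutSize G A
  cutSize-leaf A v v∈A leaf = +-cancelʳ-≤ 2 _ _ (begin
    suc (cutSize G (remove v A)) + 2                    ≡⟨ +-suc (cutSize G (remove v A)) 2 ⟨
    cutSize G (remove v A) + 3                          ≡⟨ cutSize-remove A v v∈A ⟨
    cutSize G A + (innerDegree A v + innerDegree A v)   ≤⟨ +-monoʳ-≤ (cutSize G A) (+-mono-≤ leaf leaf) ⟩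
    cutSize G A + 2                                     ∎)
    where open ≤-Reasoning

  -- An acyclic nonempty vertex set in a cubic graph is peeled leaf by leaf down to one vertex;
  -- each removal lowers the cut size.
  acyclic⇒large-cut : ∀ size A → sum (λ v → ⟦ A v ⟧) ≤ size → ∀ v → A v ≡ true →
    HasCycleIn G A ⊎ (3 ≤ cutSize G A × (∀ w → v ≢ w → A w ≡ true → 4 ≤ cutSize G A))
  acyclic⇒large-cut zero A small v v∈A = ⊥-elim (1+n≰n (begin
    1                     ≡⟨ cong ⟦_⟧ v∈A ⟨
    ⟦ A v ⟧               ≤⟨ term≤sum (λ v → ⟦ A v ⟧) v ⟩
    sum (λ v → ⟦ A v ⟧)   ≤⟨ small ⟩
    0                     ∎))
    where open ≤-Reasoning
  acyclic⇒large-cut (suc size) A small v v∈A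
    with any? (λ x → (A x Bool.≟ true) ×-dec (innerDegree A x ≤? 1))
  ... | no no-leaf = inj₁ (innerDegree≥2⇒cycle A
          (λ x x∈A → ≰⇒> (λ leaf → no-leaf (x , x∈A , leaf))) v v∈A)
  ... | yes (x , x∈A , leaf) with any? (λ w → ¬? (x ≟ w) ×-dec (A w Bool.≟ true))
  ...   | no alone = inj₂ (≤-reflexive (sym (cutSize-singleton A x x∈A only-x)) ,
          λ w v≢w w∈A → ⊥-elim (v≢w (trans (sym (is-x v v∈A)) (is-x w w∈A))))
    where
    only-x : ∀ y → x ≢ y → A y ≡ false
    only-x y x≢y = Bool.¬-not (λ y∈A → alone (y , x≢y , y∈A))
    is-x : ∀ y → A y ≡ true → x ≡ y
    is-x y y∈A = decidable-stable (x ≟ y) (λ x≢y → alone (y , x≢y , y∈A))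
  ...   | yes (w , x≢w , w∈A)
    with acyclic⇒large-cut size (remove x A)
      (+-cancelʳ-≤ 1 _ _ (subst₂ _≤_ (sym (sum-remove-< A x∈A)) (+-comm 1 size) small)) w (remove-≢ A x≢w w∈A)
  ...     | inj₁ cycle       = inj₁ (HasCycleIn-mono {G} (remove⇒ x A) cycle)
  -- The set without the leaf `x` has a cut of at least 3, and putting `x` back adds at least one.
  ...     | inj₂ (3≤ , _)    = inj₂ (≤-trans (n≤1+n 3) 4≤ , λ _ _ _ → 4≤)
    where
    4≤ : 4 ≤ cutSize G A
    4≤ = ≤-trans (s≤s 3≤) (cutSize-leaf A x x∈A leaf)

-- Cuts with two vertices on each side, and the existence of a handle.

-- Here `a`, `b` say that the source of an edge is u or v, and `c`, `d` the same for its target: an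
-- edge cut by the set of u and v is incident with one of them.
pair-cut-bound : ∀ a b c d → ⟦ (a ∨ b) xor (c ∨ d) ⟧ ≤ ⟦ a ∨ c ⟧ + ⟦ b ∨ d ⟧
pair-cut-bound true  true  true  true  = z≤n
pair-cut-bound true  true  true  false = z≤n
pair-cut-bound true  true  false true  = z≤n
pair-cut-bound true  true  false false = s≤s z≤n
pair-cut-bound true  false true  _     = z≤n
pair-cut-bound true  false false true  = z≤n
pair-cut-bound true  false false false = s≤s z≤n
pair-cut-bound false true  true  true  = z≤n
pair-cut-bound false true  true  false = z≤n
pair-cut-bound false true  false true  = z≤n
pair-cut-bound false true  false false = s≤s z≤n
pair-cut-bound false false true  _     = s≤s z≤n
pair-cut-bound false false false true  = s≤s z≤n
pair-cut-bound false false false false = z≤n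

⟦xor⟧≤ : ∀ a b → ⟦ a xor b ⟧ ≤ ⟦ a ⟧ + ⟦ b ⟧
⟦xor⟧≤ true  true  = z≤n
⟦xor⟧≤ true  false = ≤-refl
⟦xor⟧≤ false _     = ≤-refl

⟦⟧+⟦⟧≤1 : ∀ a b → (a ≡ true → b ≡ true → ⊥) → ⟦ a ⟧ + ⟦ b ⟧ ≤ 1
⟦⟧+⟦⟧≤1 true  true  excl = ⊥-elim (excl refl refl)
⟦⟧+⟦⟧≤1 true  false _    = ≤-refl
⟦⟧+⟦⟧≤1 false b     _    = ⟦⟧≤1 b

pair : Fin k → Fin k → Fin k → Bool
pair u v x = (u == x) ∨ (v == x)

two-outside-pair : 4 ≤ k → (u v : Fin k) → ∃₂ λ z w → z ≢ w × pair u v z ≡ false × pair u v w ≡ false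
two-outside-pair {k} 4≤k u v =
  let z , w , z≢w , z∉ , w∉ = sum⟦⟧≥2⇒∃₂ (λ x → not (pair u v x)) outside
  in  z , w , z≢w , Bool.not-injective z∉ , Bool.not-injective w∉
  where
  pointwise : ∀ x → 1 ≤ ⟦ u == x ⟧ + ⟦ v == x ⟧ + ⟦ not (pair u v x) ⟧
  pointwise x with u == x | v == x
  ... | true  | _     = s≤s z≤n
  ... | false | true  = s≤s z≤n
  ... | false | false = s≤s z≤n
  outside : 2 ≤ sum (λ x → ⟦ not (pair u v x) ⟧)
  outside = +-cancelˡ-≤ 2 _ _ (begin
    4 ≤⟨ 4≤k ⟩
    k ≡⟨ trans (sum-const k 1) (*-identityʳ k) ⟨
    sum {k} (λ _ → 1) ≤⟨ sum-mono pointwise ⟩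
    sum (λ x → ⟦ u == x ⟧ + ⟦ v == x ⟧ + ⟦ not (pair u v x) ⟧)
      ≡⟨ ∑-distrib-+ (λ x → ⟦ u == x ⟧ + ⟦ v == x ⟧) (λ x → ⟦ not (pair u v x) ⟧) ⟩
    sum (λ x → ⟦ u == x ⟧ + ⟦ v == x ⟧) + sum (λ x → ⟦ not (pair u v x) ⟧)
      ≡⟨ cong (_+ sum (λ x → ⟦ not (pair u v x) ⟧))
           (trans (∑-distrib-+ (λ x → ⟦ u == x ⟧) (λ x → ⟦ v == x ⟧)) (cong₂ _+_ (sum-== u) (sum-== v))) ⟩
    2 + sum (λ x → ⟦ not (pair u v x) ⟧) ∎)
    where open ≤-Reasoning

-- A path of three edges `p`, `r`, `q`. The middle edge `r` touches both of the others, which lowers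
-- the final count from 10 to 9.
record Handle (G : Multigraph) : Set where
  open Graph G
  field
    p q r    : Edge G
    u v      : Vertex G
    u∈p      : Inc u p
    u∈r      : Inc u r
    v∈r      : Inc v r
    v∈q      : Inc v q
    disjoint : ∀ x → Inc x p → Inc x q → ⊥

  p≢q : p ≢ q
  p≢q p≡q = disjoint u u∈p (subst (Inc u) p≡q u∈p)

module Essential (G : Multigraph) (cubic : IsCubic G) (cyc4 : CyclicallyFourEdgeConnected G) where
  open Multigraph G
  open Graph G
  open Cubic G cubic

  cutSize-not : ∀ A → cutSize G (λ v → not (A v)) ≡ cutSize G A
  cutSize-not A = trans (count-cong (cut-cong (λ v → Bool.xor-comm true (A v)))) (cutSize-xor A true)

  -- If both sides contain cycles, cyclic 4-edge-connectivity applies; otherwise an acyclic side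
  -- with two vertices has a large cut by peeling.
  cutSize≥4 : ∀ A {x y z w} → x ≢ y → A x ≡ true → A y ≡ true → z ≢ w → A z ≡ false → A w ≡ false →
    4 ≤ cutSize G A
  cutSize≥4 A {x} {y} {z} {w} x≢y x∈ y∈ z≢w z∉ w∉
    with acyclic⇒large-cut _ A ≤-refl x x∈
       | acyclic⇒large-cut _ (λ v → not (A v)) ≤-refl z (cong not z∉)
  ... | inj₂ (_ , large) | _                = large y x≢y y∈
  ... | inj₁ _           | inj₂ (_ , large) = subst (4 ≤_) (cutSize-not A) (large w z≢w (cong not w∉))
  ... | inj₁ cycle       | inj₁ cycle′      = cyc4 A cycle cycle′

  -- Of the six edge ends at `u` and `v`, two parallel edges use four, so the pair has a cut of at
  -- most 2, while `4 ≤ n` leaves two vertices on the other side.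
  no-parallel : 4 ≤ n → ∀ {u v e f} → u ≢ v → e ≢ f → Inc u e → Inc v e → Inc u f → Inc v f → ⊥
  no-parallel 4≤n {u} {v} {e} {f} u≢v e≢f ue ve uf vf
    with two-outside-pair 4≤n u v
  ... | z , w , z≢w , z∉ , w∉ = 1+n≰n (≤-trans (n≤1+n 3) (≤-trans (cutSize≥4 A u≢v
          (cong (_∨ (v == u)) (==-refl u)) (trans (cong ((u == v) ∨_) (==-refl v)) (Bool.∨-zeroʳ (u == v)))
          z≢w z∉ w∉) small))
    where
    A : Vertex G → Bool
    A = pair u v
    uncut : ∀ {g} → Inc u g → Inc v g → cut A g ≡ false
    uncut {g} ug vg with Inc⇒end u g ug | Inc⇒end v g vg
    ... | inj₁ u≡s | inj₁ v≡s = ⊥-elim (u≢v (trans u≡s (sym v≡s)))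
    ... | inj₂ u≡t | inj₂ v≡t = ⊥-elim (u≢v (trans u≡t (sym v≡t)))
    ... | inj₁ u≡s | inj₂ v≡t rewrite ==-true u≡s | ==-true v≡t | Bool.∨-zeroʳ (u == tgt g) = refl
    ... | inj₂ u≡t | inj₁ v≡s rewrite ==-true u≡t | ==-true v≡s | Bool.∨-zeroʳ (u == src g) = refl
    -- Each parallel edge is counted once at `u` and once at `v`, hence the weight 2.
    two : Edge G → Edge G → ℕ
    two g e = ⟦ g == e ⟧ + ⟦ g == e ⟧
    pointwise : ∀ g → ⟦ cut A g ⟧ + (two e g + two f g) ≤ ⟦ incident G u g ⟧ + ⟦ incident G v g ⟧
    pointwise g with e ≟ g | f ≟ g
    ... | yes refl | yes f≡e = ⊥-elim (e≢f (sym f≡e))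
    ... | yes refl | no  _ rewrite uncut ue ve | ue | ve = ≤-refl
    ... | no  _    | yes refl rewrite uncut uf vf | uf | vf = ≤-refl
    ... | no  _    | no  _ = subst (_≤ ⟦ incident G u g ⟧ + ⟦ incident G v g ⟧) (sym (+-identityʳ _))
                               (pair-cut-bound (u == src g) (v == src g) (u == tgt g) (v == tgt g))
    sum-two : ∀ g → sum (two g) ≡ 2
    sum-two g = trans (∑-distrib-+ (λ e → ⟦ g == e ⟧) (λ e → ⟦ g == e ⟧)) (cong₂ _+_ (sum-== g) (sum-== g))
    small : cutSize G A ≤ 2
    small = +-cancelʳ-≤ 4 _ _ (begin
      cutSize G A + 4
        ≡⟨ cong₂ _+_ (cutSize≡sum A) (sym (trans (∑-distrib-+ (two e) (two f)) (cong₂ _+_ (sum-two e) (sum-two f)))) ⟩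
      sum (λ g → ⟦ cut A g ⟧) + sum (λ g → two e g + two f g)
        ≡⟨ ∑-distrib-+ (λ g → ⟦ cut A g ⟧) (λ g → two e g + two f g) ⟨
      sum (λ g → ⟦ cut A g ⟧ + (two e g + two f g))
        ≤⟨ sum-mono pointwise ⟩
      sum (λ g → ⟦ incident G u g ⟧ + ⟦ incident G v g ⟧)
        ≡⟨ trans (∑-distrib-+ (λ g → ⟦ incident G u g ⟧) (λ g → ⟦ incident G v g ⟧))
             (cong₂ _+_ (sum-degree u) (sum-degree v)) ⟩
      2 + 4 ∎)
      where open ≤-Reasoning

  -- Let `p` be another edge at the end `u` of `r`, leading to `x`. Of the two further edges at `v`
  -- at most one meets `x`, since two would be parallel; the other one serves as `q`, and it avoids
  -- `u` because it is not parallel to `r`.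
  handle : 4 ≤ n → Edge G → Handle G
  handle 4≤n r = record
    { p = p ; q = proj₁ far ; r = r ; u = u ; v = v
    ; u∈p = u∈p ; u∈r = Inc-src r ; v∈r = Inc-tgt r ; v∈q = proj₁ (proj₂ (proj₂ far))
    ; disjoint = disjoint
    }
    where
    u v : Vertex G
    u = src r
    v = tgt r
    at-u : ∃ λ p → p ≢ r × Inc u p
    at-u = avoid (incident G u) (≤-trans (n≤1+n 2) (≤-reflexive (sym (sum-degree u)))) r
    p : Edge G
    p = proj₁ at-u
    u∈p : Inc u p
    u∈p = proj₂ (proj₂ at-u)
    x : Vertex G
    x = other u p
    p-joins : Joins G p u x
    p-joins = joins-other u p u∈p
    x∈p : Inc x p
    x∈p = proj₂ (Joins⇒Inc p-joins)
    v≢x : v ≢ x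
    v≢x v≡x = no-parallel 4≤n (loopless r) (proj₁ (proj₂ at-u)) u∈p
      (subst (λ y → Inc y p) (sym v≡x) x∈p) (Inc-src r) (Inc-tgt r)
    choices : ∃₂ λ q q′ → q ≢ q′ × remove r (incident G v) q ≡ true × remove r (incident G v) q′ ≡ true
    choices = sum⟦⟧≥2⇒∃₂ (remove r (incident G v))
      (+-cancelʳ-≤ 1 _ _ (≤-reflexive (sym (trans (sum-remove-< (incident G v) (Inc-tgt r)) (sum-degree v)))))
    far : ∃ λ q → q ≢ r × Inc v q × ¬ Inc x q
    far = let q , q′ , q≢q′ , q∈ , q′∈ = choices
              v∈q = remove⇒ r (incident G v) q q∈ ; v∈q′ = remove⇒ r (incident G v) q′ q′∈
          in pick q q′ q≢q′ v∈q v∈q′ (≢r q q∈) (≢r q′ q′∈)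
      where
      ≢r : ∀ q → remove r (incident G v) q ≡ true → q ≢ r
      ≢r q q∈ refl = true≢false (proj₂ (∧-true (incident G v q) _ q∈)) (cong not (==-refl q))
      pick : ∀ q q′ → q ≢ q′ → Inc v q → Inc v q′ → q ≢ r → q′ ≢ r → ∃ λ q → q ≢ r × Inc v q × ¬ Inc x q
      pick q q′ q≢q′ v∈q v∈q′ q≢r q′≢r with incident G x q in x∈q
      ... | false = q , q≢r , v∈q , λ eq → true≢false eq x∈q
      ... | true  = q′ , q′≢r , v∈q′ , no-parallel 4≤n v≢x q≢q′ v∈q x∈q v∈q′
    disjoint : ∀ y → Inc y p → Inc y (proj₁ far) → ⊥
    disjoint y y∈p y∈q with Joins-end p y p-joins y∈p
    ... | inj₁ refl = no-parallel 4≤n (loopless r) (proj₁ (proj₂ far)) y∈q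
      (proj₁ (proj₂ (proj₂ far))) (Inc-src r) (Inc-tgt r)
    ... | inj₂ refl = proj₂ (proj₂ (proj₂ far)) y∈q

-- Cuts of the graph with the two handle edges deleted or cut open.

if-∨ : ∀ a b {x y : ℕ} → (a ≡ false → b ≡ false → x ≡ y) →
  (if a ∨ b then 0 else x) ≡ (if a ∨ b then 0 else y)
if-∨ true  _     _ = refl
if-∨ false true  _ = refl
if-∨ false false h = h refl refl

module HandleCuts (G : Multigraph) (cubic : IsCubic G) (cyc4 : CyclicallyFourEdgeConnected G) (H : Handle G) where
  open Multigraph G
  open Graph G
  open Cubic G cubic
  open Essential G cubic cyc4
  open Handle H using (p; q; p≢q; disjoint)

  -- The cut size in `G` with `p` and `q` deleted: in the cover, the part of a cut formed by edges
  -- that stay within one sheet.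
  rest : (Vertex G → Bool) → ℕ
  rest A = sum (λ e → if (p == e) ∨ (q == e) then 0 else ⟦ cut A e ⟧)

  cutSize-rest : ∀ A → cutSize G A ≡ rest A + (⟦ cut A p ⟧ + ⟦ cut A q ⟧)
  cutSize-rest A = trans (cutSize≡sum A) (sum-split-two p≢q (λ e → ⟦ cut A e ⟧))

  rest-xor : ∀ A β → rest (λ v → A v xor β) ≡ rest A
  rest-xor A β = sum-cong-≗ (λ e → cong (λ c → if (p == e) ∨ (q == e) then 0 else ⟦ c ⟧) (cut-xor A β e))

  -- A vertex lies on at most one of the disjoint edges `p` and `q`, so at least two of its three
  -- edges remain.
  rest-singleton : ∀ A x → A x ≡ true → (∀ y → x ≢ y → A y ≡ false) → 2 ≤ rest A
  rest-singleton A x x∈A only = +-cancelʳ-≤ 1 _ _ (begin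
    3                                          ≡⟨ cutSize-singleton A x x∈A only ⟨
    cutSize G A                                ≡⟨ cutSize-rest A ⟩
    rest A + (⟦ cut A p ⟧ + ⟦ cut A q ⟧)       ≤⟨ +-monoʳ-≤ (rest A) (⟦⟧+⟦⟧≤1 _ _ at-most-one) ⟩
    rest A + 1                                 ∎)
    where
    open ≤-Reasoning
    at-most-one : cut A p ≡ true → cut A q ≡ true → ⊥
    at-most-one cp cq = disjoint x (trans (sym (cut-singleton A x x∈A only p)) cp)
                                   (trans (sym (cut-singleton A x x∈A only q)) cq)

  Another : (Vertex G → Bool) → Vertex G → Bool → Set
  Another A x β = ∃ λ y → x ≢ y × A y ≡ β

  another? : ∀ A x β → Dec (Another A x β)
  another? A x β = any? (λ y → ¬? (x ≟ y) ×-dec (A y Bool.≟ β))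

  -- A side with a single vertex is the previous case. With two vertices on each side the cut has
  -- size at least 4, of which `p` and `q` take at most 2.
  rest≥2 : ∀ A {x y} → A x ≡ true → A y ≡ false → 2 ≤ rest A
  rest≥2 A {x} {y} x∈A y∉A with another? A x true | another? A y false
  ... | no alone | _ = rest-singleton A x x∈A (λ z x≢z → Bool.¬-not (λ z∈A → alone (z , x≢z , z∈A)))
  ... | _ | no alone = subst (2 ≤_) (rest-xor A true)
          (rest-singleton (λ v → A v xor true) y (cong (_xor true) y∉A)
            (λ z y≢z → cong (_xor true) (Bool.¬-not (λ z∉A → alone (z , y≢z , z∉A)))))
  ... | yes (x′ , x≢x′ , x′∈A) | yes (y′ , y≢y′ , y′∉A) = +-cancelʳ-≤ 2 _ _ (begin
    4                                          ≤⟨ cutSize≥4 A x≢x′ x∈A x′∈A y≢y′ y∉A y′∉A ⟩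
    cutSize G A                                ≡⟨ cutSize-rest A ⟩
    rest A + (⟦ cut A p ⟧ + ⟦ cut A q ⟧)       ≤⟨ +-monoʳ-≤ (rest A) (+-mono-≤ (⟦⟧≤1 (cut A p)) (⟦⟧≤1 (cut A q))) ⟩
    rest A + 2                                 ∎)
    where open ≤-Reasoning

  -- Here each end of p and q lying in A is charged, as in a copy of G with p and q cut open
  -- whose surroundings lie outside A.
  opened-cut≥4 : ∀ A {x y z} → x ≢ y → A x ≡ true → A y ≡ true → A z ≡ false →
    4 ≤ rest A + ((⟦ A (src p) ⟧ + ⟦ A (tgt p) ⟧) + (⟦ A (src q) ⟧ + ⟦ A (tgt q) ⟧))
  opened-cut≥4 A {x} {y} {z} x≢y x∈A y∈A z∉A with another? A z false
  ... | yes (w , z≢w , w∉A) = begin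
    4                                          ≤⟨ cutSize≥4 A x≢y x∈A y∈A z≢w z∉A w∉A ⟩
    cutSize G A                                ≡⟨ cutSize-rest A ⟩
    rest A + (⟦ cut A p ⟧ + ⟦ cut A q ⟧)       ≤⟨ +-monoʳ-≤ (rest A) (+-mono-≤
                                                    (⟦xor⟧≤ (A (src p)) (A (tgt p))) (⟦xor⟧≤ (A (src q)) (A (tgt q)))) ⟩
    rest A + ((⟦ A (src p) ⟧ + ⟦ A (tgt p) ⟧) + (⟦ A (src q) ⟧ + ⟦ A (tgt q) ⟧)) ∎
    where open ≤-Reasoning
  -- Now `z` is the only vertex outside `A`. Neither `p` nor `q` is a loop, so each has an end in
  -- `A` and adds 1 to the 2 from `rest`.
  ... | no alone = +-mono-≤ (rest≥2 A x∈A z∉A) (+-mono-≤ (an-end p) (an-end q))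
    where
    an-end : ∀ e → 1 ≤ ⟦ A (src e) ⟧ + ⟦ A (tgt e) ⟧
    an-end e with A (src e) in s | A (tgt e) in t
    ... | true  | _     = s≤s z≤n
    ... | false | true  = s≤s z≤n
    ... | false | false = ⊥-elim (alone (other z e , z≢other , other∉A))
      where
      z≢other : z ≢ other z e
      z≢other eq with z ≟ src e
      ... | yes refl = loopless e eq
      ... | no  z≢s  = z≢s eq
      other∉A : A (other z e) ≡ false
      other∉A with z ≟ src e
      ... | yes _ = t
      ... | no  _ = s

-- The cyclic cover.

combine-== : (i j : Fin k) (x y : Fin l) →
  ⟦ combine i x == combine j y ⟧ ≡ (if i == j then ⟦ x == y ⟧ else 0)
combine-== i j x y with i ≟ j
... | no i≢j = cong ⟦_⟧ (==-false (i≢j ∘ combine-injectiveˡ i x j y))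
... | yes refl with x ≟ y
...   | yes refl = cong ⟦_⟧ (==-refl (combine i x))
...   | no  x≢y  = cong ⟦_⟧ (==-false (x≢y ∘ combine-injectiveʳ i x i y))

-- There are at least two sheets, so that next has no fixed point.
module Cover (G : Multigraph) (H : Handle G) (k : ℕ) where
  open Multigraph G
  open Graph G
  open Handle H using (p; q)

  sheets : ℕ
  sheets = suc (suc k)

  Sheet : Set
  Sheet = Fin sheets

  -- The copy of `e` with source in sheet `i` has its target in sheet `shift e i`; the stored order
  -- of the ends serves as the orientation.
  shift : Edge G → Sheet → Sheet
  shift e i = if (p == e) ∨ (q == e) then next i else i

  unshift : Edge G → Sheet → Sheet
  unshift e i = if (p == e) ∨ (q == e) then prev i else i

  -- `prev` inverts `next`. On the right `j` is compared with a fixed sheet, so a sum over `j` can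
  -- be evaluated by `sum-indicator`.
  shift-== : ∀ e i j → (i == shift e j) ≡ (unshift e i == j)
  shift-== e i j with (p == e) ∨ (q == e)
  ... | false = refl
  ... | true with i ≟ next j
  ...   | yes refl = sym (==-true {i = prev (next j)} (prev-next j))
  ...   | no  i≢   = sym (==-false {i = prev i} {j} (λ eq → i≢ (trans (sym (next-prev i)) (cong next eq))))

  shift-p : ∀ i → shift p i ≡ next i
  shift-p i rewrite ==-refl p = refl

  shift-q : ∀ i → shift q i ≡ next i
  shift-q i rewrite ==-refl q | Bool.∨-zeroʳ (p == q) = refl

  shift-other : ∀ {e} → p ≢ e → q ≢ e → ∀ i → shift e i ≡ i
  shift-other p≢e q≢e i rewrite ==-false p≢e | ==-false q≢e = refl

  lift : Sheet × Edge G → Fin (sheets * n) × Fin (sheets * n)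
  lift (i , e) = combine i (src e) , combine (shift e i) (tgt e)

  cover : Multigraph
  cover = record
    { n = sheets * n
    ; m = sheets * m
    ; ends = λ e → lift (remQuot m e)
    ; loopless = λ e → let (i , f) = remQuot m e in
        λ eq → loopless f (combine-injectiveʳ i (src f) (shift f i) (tgt f) eq)
    }

  module R = Graph cover

  _at_ : Vertex G → Sheet → Vertex cover
  x at i = combine i x

  _over_ : Edge G → Sheet → Edge cover
  e over i = combine i e

  ends-over : ∀ i e → Multigraph.ends cover (e over i) ≡ lift (i , e)
  ends-over i e = cong lift (remQuot-combine i e)

  src-over : ∀ i e → R.src (e over i) ≡ (src e at i)
  src-over i e = cong proj₁ (ends-over i e)

  tgt-over : ∀ i e → R.tgt (e over i) ≡ (tgt e at shift e i)
  tgt-over i e = cong proj₂ (ends-over i e)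

  incident-over : ∀ i x j e → ⟦ incident cover (x at i) (e over j) ⟧ ≡
    (if i == j then ⟦ x == src e ⟧ else 0) + (if unshift e i == j then ⟦ x == tgt e ⟧ else 0)
  incident-over i x j e = begin
    ⟦ incident cover (x at i) (e over j) ⟧
      ≡⟨ R.incident-split (x at i) (e over j) ⟩
    ⟦ (x at i) == R.src (e over j) ⟧ + ⟦ (x at i) == R.tgt (e over j) ⟧
      ≡⟨ cong₂ (λ s t → ⟦ (x at i) == s ⟧ + ⟦ (x at i) == t ⟧) (src-over j e) (tgt-over j e) ⟩
    ⟦ (x at i) == (src e at j) ⟧ + ⟦ (x at i) == (tgt e at shift e j) ⟧
      ≡⟨ cong₂ _+_ (combine-== i j x (src e)) (combine-== i (shift e j) x (tgt e)) ⟩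
    (if i == j then ⟦ x == src e ⟧ else 0) + (if i == shift e j then ⟦ x == tgt e ⟧ else 0)
      ≡⟨ cong (λ b → (if i == j then ⟦ x == src e ⟧ else 0) + (if b then ⟦ x == tgt e ⟧ else 0)) (shift-== e i j) ⟩
    (if i == j then ⟦ x == src e ⟧ else 0) + (if unshift e i == j then ⟦ x == tgt e ⟧ else 0) ∎
    where open ≡-Reasoning

  -- Among the copies of an edge exactly one has its source in sheet `i` and exactly one its target,
  -- so the fibre of each edge contributes as much as the edge does in `G`.
  cover-degree : ∀ i x → degree cover (x at i) ≡ degree G x
  cover-degree i x = begin
    degree cover (x at i)
      ≡⟨ trans (count≡sum (incident cover (x at i))) (sum-combine {sheets} {m} (λ e → ⟦ incident cover (x at i) e ⟧)) ⟩
    sum {sheets} (λ j → sum (λ e → ⟦ incident cover (x at i) (e over j) ⟧))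
      ≡⟨ ∑-comm {sheets} {m} (λ j e → ⟦ incident cover (x at i) (e over j) ⟧) ⟩
    sum (λ e → sum {sheets} (λ j → ⟦ incident cover (x at i) (e over j) ⟧))
      ≡⟨ sum-cong-≗ fibre ⟩
    sum (λ e → ⟦ incident G x e ⟧)
      ≡⟨ count≡sum (incident G x) ⟨
    degree G x ∎
    where
    open ≡-Reasoning
    fibre : ∀ e → sum {sheets} (λ j → ⟦ incident cover (x at i) (e over j) ⟧) ≡ ⟦ incident G x e ⟧
    fibre e = begin
      sum {sheets} (λ j → ⟦ incident cover (x at i) (e over j) ⟧)
        ≡⟨ sum-cong-≗ (λ j → incident-over i x j e) ⟩
      sum {sheets} (λ j → (if i == j then ⟦ x == src e ⟧ else 0) + (if unshift e i == j then ⟦ x == tgt e ⟧ else 0))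
        ≡⟨ ∑-distrib-+ (λ j → if i == j then ⟦ x == src e ⟧ else 0)
                       (λ j → if unshift e i == j then ⟦ x == tgt e ⟧ else 0) ⟩
      sum {sheets} (λ j → if i == j then ⟦ x == src e ⟧ else 0) +
      sum {sheets} (λ j → if unshift e i == j then ⟦ x == tgt e ⟧ else 0)
        ≡⟨ cong₂ _+_ (sum-indicator i (λ _ → ⟦ x == src e ⟧)) (sum-indicator (unshift e i) (λ _ → ⟦ x == tgt e ⟧)) ⟩
      ⟦ x == src e ⟧ + ⟦ x == tgt e ⟧
        ≡⟨ incident-split x e ⟨
      ⟦ incident G x e ⟧ ∎

  cover-cubic : IsCubic G → IsCubic cover
  cover-cubic cubic v with combine-surjective {sheets} {n} v
  ... | i , x , refl = trans (cover-degree i x) (cubic x)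

-- Cuts of the cover.

xor-not : ∀ {a b β} → a ≡ β → b ≡ not β → a xor b ≡ true
xor-not {β = true}  refl refl = refl
xor-not {β = false} refl refl = refl

≢⇒xor : ∀ {a β} → a ≡ not β → a xor β ≡ true
≢⇒xor {β = true}  refl = refl
≢⇒xor {β = false} refl = refl

module CoverCuts (G : Multigraph) (cubic : IsCubic G) (cyc4 : CyclicallyFourEdgeConnected G)
                 (H : Handle G) (k : ℕ) where
  open Multigraph G
  open Graph G
  open Handle H using (p; q; p≢q)
  open HandleCuts G cubic cyc4 H
  open Cover G H k

  module _ (Z : Sheet → Vertex G → Bool) where

    -- `Z` is a vertex set of the cover given sheet by sheet. Each edge is assigned to the sheet of
    -- its source, so the rows partition the cut.
    rowCut : Sheet → Edge G → Bool
    rowCut i e = Z i (src e) xor Z (shift e i) (tgt e)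

    row : Sheet → ℕ
    row i = sum (λ e → ⟦ rowCut i e ⟧)

    crossing : Sheet → Edge G → ℕ
    crossing i e = ⟦ Z i (src e) xor Z (next i) (tgt e) ⟧

    row-split : ∀ i → row i ≡ rest (Z i) + (crossing i p + crossing i q)
    row-split i = trans (sum-split-two p≢q (λ e → ⟦ rowCut i e ⟧))
      (cong₂ _+_ (sum-cong-≗ inside)
        (cong₂ _+_ (cong (λ j → ⟦ Z i (src p) xor Z j (tgt p) ⟧) (shift-p i))
                   (cong (λ j → ⟦ Z i (src q) xor Z j (tgt q) ⟧) (shift-q i))))
      where
      inside : ∀ e → (if (p == e) ∨ (q == e) then 0 else ⟦ rowCut i e ⟧) ≡
                     (if (p == e) ∨ (q == e) then 0 else ⟦ cut (Z i) e ⟧)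
      inside e with p ≟ e | q ≟ e
      ... | yes _ | _     = refl
      ... | no  _ | yes _ = refl
      ... | no  _ | no  _ = refl

    Mixed : Sheet → Set
    Mixed i = (∃ λ x → Z i x ≡ true) × (∃ λ y → Z i y ≡ false)

    mixed? : ∀ i → Dec (Mixed i)
    mixed? i = any? (λ x → Z i x Bool.≟ true) ×-dec any? (λ y → Z i y Bool.≟ false)

    mixed⇒row≥2 : ∀ {i} → Mixed i → 2 ≤ row i
    mixed⇒row≥2 {i} ((x , x∈) , (y , y∉)) =
      subst (2 ≤_) (sym (row-split i)) (≤-trans (rest≥2 (Z i) x∈ y∉) (m≤m+n _ _))

    -- A fixed vertex at which the side of an unmixed sheet is read off.
    base : Vertex G
    base = src p

    uniform : ∀ {i} → ¬ Mixed i → ∀ x → Z i x ≡ Z i base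
    uniform {i} ¬mixed x with Z i x in Zx | Z i base in Zb
    ... | true  | true  = refl
    ... | false | false = refl
    ... | true  | false = ⊥-elim (¬mixed ((x , Zx) , (base , Zb)))
    ... | false | true  = ⊥-elim (¬mixed ((base , Zb) , (x , Zx)))

    -- The copies of `p` and `q` starting in sheet `i` both end in the next sheet, hence both are
    -- cut.
    jump⇒row≥2 : ∀ {i β} → ¬ Mixed i → ¬ Mixed (next i) → Z i base ≡ β → Z (next i) base ≡ not β → 2 ≤ row i
    jump⇒row≥2 {i} ¬mixed ¬mixed′ Zi Zi′ =
      subst (2 ≤_) (sym (row-split i)) (≤-trans (+-mono-≤ (crosses p) (crosses q)) (m≤n+m _ (rest (Z i))))
      where
      crosses : ∀ e → 1 ≤ crossing i e
      crosses e = ≤-reflexive (sym (cong ⟦_⟧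
        (xor-not (trans (uniform ¬mixed (src e)) Zi) (trans (uniform ¬mixed′ (tgt e)) Zi′))))

    two-rows : ∀ {i j} → i ≢ j → 2 ≤ row i → 2 ≤ row j → 4 ≤ sum row
    two-rows i≢j 2≤i 2≤j = ≤-trans (+-mono-≤ 2≤i 2≤j) (two-terms≤sum row i≢j)

    -- What is retained of a cycle on the side `β`.
    Two : Bool → Set
    Two β = ∃₂ λ i x → ∃₂ λ j y → Z i x ≡ β × Z j y ≡ β × ¬ (i ≡ j × x ≡ y)

    -- Both sides are occupied, so the labels of the uniform sheets are not constant. Around the
    -- cycle they fall somewhere and rise somewhere, and each change costs 2.
    unmixed⇒cut≥4 : (∀ i → ¬ Mixed i) → (∀ β → Two β) → 4 ≤ sum row
    unmixed⇒cut≥4 ¬mixed two with constant-or-changes (λ i → Z i base)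
    ... | inj₁ (γ , constant) with two (not γ)
    ...   | i , x , _ , _ , Zix , _ =
      ⊥-elim (Bool.not-¬ (constant i) (trans (sym (uniform (¬mixed i) x)) Zix))
    unmixed⇒cut≥4 ¬mixed two | inj₂ (s , t , (Zs , Zs′) , (Zt , Zt′)) =
      two-rows s≢t (jump⇒row≥2 (¬mixed _) (¬mixed _) Zs Zs′) (jump⇒row≥2 (¬mixed _) (¬mixed _) Zt Zt′)
      where
      s≢t : s ≢ t
      s≢t refl = true≢false Zs Zt

    -- All sheets but one are uniform: the mixed sheet i gets the label of its successor, so that
    -- a change of label that is not entering i happens between two uniform sheets.
    module OneMixed (i : Sheet) (mixed : Mixed i) (others : ∀ j → j ≢ i → ¬ Mixed j) where

      label : Sheet → Bool
      label j = if i == j then Z (next i) base else Z j base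

      label-i : label i ≡ Z (next i) base
      label-i rewrite ==-refl i = refl

      label-≢ : ∀ {j} → j ≢ i → label j ≡ Z j base
      label-≢ j≢i rewrite ==-false (j≢i ∘ sym) = refl

      -- The sheet `i` shares its label with its successor, so the change does not leave `i`. Two
      -- uniform sheets thus pay 2, and the mixed sheet pays another 2.
      change⇒cut≥4 : ∀ β s → label s ≡ β → label (next s) ≡ not β → next s ≢ i → 4 ≤ sum row
      change⇒cut≥4 β s ls ls′ s′≢i with s ≟ i
      ... | yes refl = ⊥-elim (Bool.not-¬ (trans (sym label-i) ls) (trans (sym (label-≢ s′≢i)) ls′))
      ... | no  s≢i  = two-rows (s≢i ∘ sym) (mixed⇒row≥2 mixed)
        (jump⇒row≥2 (others s s≢i) (others (next s) s′≢i) (trans (sym (label-≢ s≢i)) ls) (trans (sym (label-≢ s′≢i)) ls′))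

      outside : ∀ {γ} → (∀ j → label j ≡ γ) → ∀ {j} → j ≢ i → ∀ x → Z j x ≡ γ
      outside constant {j} j≢i x = trans (uniform (others j j≢i) x) (trans (sym (label-≢ j≢i)) (constant j))

      -- The side `not γ` lies entirely in sheet `i`, which acts as `G` with `p` and `q` cut open. A
      -- source in `S` makes an edge of row `i` cross; a target in `S` makes an edge of row `prev i`
      -- cross.
      constant⇒cut≥4 : ∀ γ → (∀ j → label j ≡ γ) → Two (not γ) → ∃ (λ z → Z i z ≡ γ) → 4 ≤ sum row
      constant⇒cut≥4 γ constant (j , x , j′ , y , Zx , Zy , distinct) (z , Zz)
        with in-i j x Zx | in-i j′ y Zy
        where
        in-i : ∀ j x → Z j x ≡ not γ → j ≡ i
        in-i j x Zx = decidable-stable (j ≟ i) (λ j≢i → Bool.not-¬ (outside constant j≢i x) Zx)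
      ... | refl | refl = begin
        4
          ≤⟨ opened-cut≥4 S (λ x≡y → distinct (refl , x≡y)) (≢⇒xor Zx) (≢⇒xor Zy)
               (trans (cong (_xor γ) Zz) (Bool.xor-same γ)) ⟩
        rest S + ((⟦ S (src p) ⟧ + ⟦ S (tgt p) ⟧) + (⟦ S (src q) ⟧ + ⟦ S (tgt q) ⟧))
          ≡⟨ cong₂ _+_ (rest-xor (Z i) γ) (solve 4 (λ a b c d → (a :+ b) :+ (c :+ d) := (a :+ c) :+ (b :+ d)) refl
               ⟦ S (src p) ⟧ ⟦ S (tgt p) ⟧ ⟦ S (src q) ⟧ ⟦ S (tgt q) ⟧) ⟩
        rest (Z i) + ((⟦ S (src p) ⟧ + ⟦ S (src q) ⟧) + (⟦ S (tgt p) ⟧ + ⟦ S (tgt q) ⟧))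
          ≡⟨ +-assoc (rest (Z i)) _ _ ⟨
        rest (Z i) + (⟦ S (src p) ⟧ + ⟦ S (src q) ⟧) + (⟦ S (tgt p) ⟧ + ⟦ S (tgt q) ⟧)
          ≡⟨ cong₂ (λ a b → rest (Z i) + a + b)
               (cong₂ _+_ (leaving p) (leaving q)) (cong₂ _+_ (entering p) (entering q)) ⟩
        rest (Z i) + (crossing i p + crossing i q) + (crossing (prev i) p + crossing (prev i) q)
          ≤⟨ +-mono-≤ (≤-reflexive (sym (row-split i)))
               (≤-trans (m≤n+m _ (rest (Z (prev i)))) (≤-reflexive (sym (row-split (prev i))))) ⟩
        row i + row (prev i)
          ≤⟨ two-terms≤sum row (λ i≡prev → next≢ i (trans (cong next i≡prev) (next-prev i))) ⟩
        sum row ∎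
        where
        open ≤-Reasoning
        S : Vertex G → Bool
        S v = Z i v xor γ
        leaving : ∀ e → ⟦ S (src e) ⟧ ≡ crossing i e
        leaving e = cong (λ b → ⟦ Z i (src e) xor b ⟧) (sym (outside constant (next≢ i) (tgt e)))
        entering : ∀ e → ⟦ S (tgt e) ⟧ ≡ crossing (prev i) e
        entering e = cong ⟦_⟧ (trans (Bool.xor-comm (Z i (tgt e)) γ)
          (cong₂ _xor_ (sym (outside constant prev≢ (src e))) (cong (λ j → Z j (tgt e)) (sym (next-prev i)))))
          where
          prev≢ : prev i ≢ i
          prev≢ eq = next≢ i (trans (cong next (sym eq)) (next-prev i))

      one-mixed⇒cut≥4 : (∀ β → Two β) → 4 ≤ sum row
      one-mixed⇒cut≥4 two with constant-or-changes label
      ... | inj₁ (true  , constant) = constant⇒cut≥4 true constant (two false) (proj₁ mixed)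
      ... | inj₁ (false , constant) = constant⇒cut≥4 false constant (two true) (proj₂ mixed)
      ... | inj₂ (s , t , (ls , ls′) , (lt , lt′)) with next s ≟ i
      ...   | no  s′≢i = change⇒cut≥4 true s ls ls′ s′≢i
      -- If the fall enters `i`, then `i` is labelled `false`, so the rise enters a different sheet
      -- and can be used instead.
      ...   | yes s′≡i = change⇒cut≥4 false t lt lt′
        (λ t′≡i → true≢false lt′ (trans (cong label (trans t′≡i (sym s′≡i))) ls′))

    -- Cases by the number of mixed sheets: none, at least two, exactly one.
    sheets-cut≥4 : (∀ β → Two β) → 4 ≤ sum row
    sheets-cut≥4 two with any? mixed?
    ... | no none = unmixed⇒cut≥4 (λ i mixed → none (i , mixed)) two
    ... | yes (i , mixed) with any? (λ j → ¬? (j ≟ i) ×-dec mixed? j)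
    ...   | yes (j , j≢i , mixed′) = two-rows j≢i (mixed⇒row≥2 mixed′) (mixed⇒row≥2 mixed)
    ...   | no  none = OneMixed.one-mixed⇒cut≥4 i mixed (λ j j≢i mixed′ → none (j , j≢i , mixed′)) two

  cover-cyc4 : CyclicallyFourEdgeConnected cover
  cover-cyc4 X cycle cycle′ = subst (4 ≤_) (sym cutSize≡rows) (sheets-cut≥4 Z two)
    where
    Z : Sheet → Vertex G → Bool
    Z i x = X (x at i)
    cutSize≡rows : cutSize cover X ≡ sum (row Z)
    cutSize≡rows = begin
      cutSize cover X
        ≡⟨ R.cutSize≡sum X ⟩
      sum (λ e → ⟦ R.cut X e ⟧)
        ≡⟨ sum-combine {sheets} {m} (λ e → ⟦ R.cut X e ⟧) ⟩
      sum {sheets} (λ i → sum (λ e → ⟦ R.cut X (e over i) ⟧))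
        ≡⟨ sum-cong-≗ (λ i → sum-cong-≗ (λ e → cong₂ (λ s t → ⟦ X s xor X t ⟧) (src-over i e) (tgt-over i e))) ⟩
      sum (row Z) ∎
      where open ≡-Reasoning
    -- A cycle has length at least 2, and its first two vertices are distinct.
    two-on-cycle : ∀ β (Y : Vertex cover → Bool) → (∀ v → Y v ≡ true → X v ≡ β) → HasCycleIn cover Y → Two Z β
    two-on-cycle β Y Y⇒ (_ , vs , _ , vs-inj , _ , vs∈ , _)
      with combine-surjective {sheets} {n} (vs zero) | combine-surjective {sheets} {n} (vs (suc zero))
    ... | i , x , v₀ | j , y , v₁ = i , x , j , y ,
      trans (cong X v₀) (Y⇒ _ (vs∈ zero)) , trans (cong X v₁) (Y⇒ _ (vs∈ (suc zero))) ,
      λ (i≡j , x≡y) → 0≢1 (vs-inj zero (suc zero) (trans (sym v₀) (trans (cong₂ combine i≡j x≡y) v₁)))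
      where
      0≢1 : zero ≢ suc zero
      0≢1 ()
    two : ∀ β → Two Z β
    two true  = two-on-cycle true X (λ _ eq → eq) cycle
    two false = two-on-cycle false (λ v → not (X v)) (λ _ eq → Bool.not-injective eq) cycle′

-- Greedy recolouring and the edges near the handle.

⟦∨⟧≤ : ∀ a b → ⟦ a ∨ b ⟧ ≤ ⟦ a ⟧ + ⟦ b ⟧
⟦∨⟧≤ true  _ = s≤s z≤n
⟦∨⟧≤ false _ = ≤-refl

module Colour (G : Multigraph) (cubic : IsCubic G) where
  open Multigraph G
  open Graph G
  open Cubic G cubic

  touches : Edge G → Edge G → Bool
  touches e f = incident G (src e) f ∨ incident G (tgt e) f

  Inc⇒touches : ∀ v e f → Inc v e → Inc v f → touches e f ≡ true
  Inc⇒touches v e f v∈e v∈f with Inc⇒end v e v∈e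
  ... | inj₁ refl = cong (_∨ incident G (tgt e) f) v∈f
  ... | inj₂ refl = trans (cong (incident G (src e) f ∨_) v∈f) (Bool.∨-zeroʳ _)

  touches⇒Inc : ∀ e f → touches e f ≡ true → ∃ λ v → Inc v e × Inc v f
  touches⇒Inc e f t with ∨-true (incident G (src e) f) _ t
  ... | inj₁ s∈f = src e , Inc-src e , s∈f
  ... | inj₂ t∈f = tgt e , Inc-tgt e , t∈f

  touches-sym : ∀ e f → touches e f ≡ true → touches f e ≡ true
  touches-sym e f t with touches⇒Inc e f t
  ... | v , v∈e , v∈f = Inc⇒touches v f e v∈f v∈e

  sum-ends : ∀ e → sum (λ f → ⟦ incident G (src e) f ⟧ + ⟦ incident G (tgt e) f ⟧) ≡ 6
  sum-ends e = trans (∑-distrib-+ (λ f → ⟦ incident G (src e) f ⟧) (λ f → ⟦ incident G (tgt e) f ⟧))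
                     (cong₂ _+_ (sum-degree (src e)) (sum-degree (tgt e)))

  neighbour : Edge G → Edge G → Bool
  neighbour e f = touches e f ∧ not (e == f)

  -- The two ends of `e` carry six incidences, two of which belong to `e` itself.
  neighbours≤4 : ∀ e → sum (λ f → ⟦ neighbour e f ⟧) ≤ 4
  neighbours≤4 e = +-cancelʳ-≤ 2 _ _ (begin
    sum (λ f → ⟦ neighbour e f ⟧) + 2
      ≡⟨ cong (sum (λ f → ⟦ neighbour e f ⟧) +_)
           (trans (∑-distrib-+ (λ f → ⟦ e == f ⟧) (λ f → ⟦ e == f ⟧)) (cong₂ _+_ (sum-== e) (sum-== e))) ⟨
    sum (λ f → ⟦ neighbour e f ⟧) + sum (λ f → ⟦ e == f ⟧ + ⟦ e == f ⟧)
      ≡⟨ ∑-distrib-+ (λ f → ⟦ neighbour e f ⟧) (λ f → ⟦ e == f ⟧ + ⟦ e == f ⟧) ⟨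
    sum (λ f → ⟦ neighbour e f ⟧ + (⟦ e == f ⟧ + ⟦ e == f ⟧))
      ≤⟨ sum-mono pointwise ⟩
    sum (λ f → ⟦ incident G (src e) f ⟧ + ⟦ incident G (tgt e) f ⟧)
      ≡⟨ sum-ends e ⟩
    6 ∎)
    where
    open ≤-Reasoning
    pointwise : ∀ f →
      ⟦ neighbour e f ⟧ + (⟦ e == f ⟧ + ⟦ e == f ⟧) ≤ ⟦ incident G (src e) f ⟧ + ⟦ incident G (tgt e) f ⟧
    pointwise f with e ≟ f
    ... | yes refl rewrite Inc-src e | Inc-tgt e = ≤-refl
    ... | no  _ = subst (_≤ ⟦ incident G (src e) f ⟧ + ⟦ incident G (tgt e) f ⟧)
                    (sym (trans (+-identityʳ _) (cong ⟦_⟧ (Bool.∧-identityʳ (touches e f)))))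
                    (⟦∨⟧≤ (incident G (src e) f) (incident G (tgt e) f))

  abstract
    -- At most four neighbours leave one of five colours free. The result is opaque, so later
    -- arguments rest on the two stated properties alone.
    recolour : ∀ (c : EdgeColoring5 G) e → ∃ λ (c′ : EdgeColoring5 G) →
      (∀ f → e ≢ f → c′ f ≡ c f) × (∀ f → e ≢ f → touches e f ≡ true → c′ e ≢ c′ f)
    recolour c e with free-value c (neighbour e) (s≤s (neighbours≤4 e))
    ... | x , free = c′ , unchanged , λ f e≢f t eq →
          free f (cong₂ _∧_ t (cong not (==-false e≢f))) (trans (sym (unchanged f e≢f)) (trans (sym eq) c′e≡x))
      where
      c′ : EdgeColoring5 G
      c′ f = if e == f then x else c f
      unchanged : ∀ f → e ≢ f → c′ f ≡ c f
      unchanged f e≢f rewrite ==-false e≢f = refl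
      c′e≡x : c′ e ≡ x
      c′e≡x rewrite ==-refl e = refl

  module _ (H : Handle G) where
    open Handle H

    near : Edge G → Bool
    near e = touches p e ∨ touches q e

    -- The four ends of `p` and `q` carry 12 incidences. `p` and `q` are each counted at both of
    -- their own ends, and `r` once at each of `p` and `q`; this surplus of 3 is `extra`.
    near≤9 : sum (λ e → ⟦ near e ⟧) ≤ 9
    near≤9 = +-cancelʳ-≤ 3 _ _ (begin
      sum (λ e → ⟦ near e ⟧) + 3
        ≡⟨ cong (sum (λ e → ⟦ near e ⟧) +_) sum-extra ⟨
      sum (λ e → ⟦ near e ⟧) + sum extra
        ≡⟨ ∑-distrib-+ (λ e → ⟦ near e ⟧) extra ⟨
      sum (λ e → ⟦ near e ⟧ + extra e)
        ≤⟨ sum-mono pointwise ⟩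
      sum (λ e → at-ends p e + at-ends q e)
        ≡⟨ trans (∑-distrib-+ (at-ends p) (at-ends q)) (cong₂ _+_ (sum-ends p) (sum-ends q)) ⟩
      12 ∎)
      where
      open ≤-Reasoning
      at-ends : Edge G → Edge G → ℕ
      at-ends e f = ⟦ incident G (src e) f ⟧ + ⟦ incident G (tgt e) f ⟧
      extra : Edge G → ℕ
      extra e = ⟦ p == e ⟧ + (⟦ q == e ⟧ + ⟦ r == e ⟧)
      sum-extra : sum extra ≡ 3
      sum-extra = trans (∑-distrib-+ (λ e → ⟦ p == e ⟧) (λ e → ⟦ q == e ⟧ + ⟦ r == e ⟧))
        (cong₂ _+_ (sum-== p) (trans (∑-distrib-+ (λ e → ⟦ q == e ⟧) (λ e → ⟦ r == e ⟧)) (cong₂ _+_ (sum-== q) (sum-== r))))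
      p≢r : p ≢ r
      p≢r refl = disjoint v v∈r v∈q
      q≢r : q ≢ r
      q≢r refl = disjoint u u∈p u∈r
      at-ends-self : ∀ e → at-ends e e ≡ 2
      at-ends-self e rewrite Inc-src e | Inc-tgt e = refl
      at-ends≥1 : ∀ e f → touches e f ≡ true → 1 ≤ at-ends e f
      at-ends≥1 e f t = subst (_≤ at-ends e f) (cong ⟦_⟧ t) (⟦∨⟧≤ (incident G (src e) f) (incident G (tgt e) f))
      pointwise : ∀ e → ⟦ near e ⟧ + extra e ≤ at-ends p e + at-ends q e
      pointwise e with p ≟ e | q ≟ e | r ≟ e
      ... | yes refl | yes eq   | _        = ⊥-elim (p≢q (sym eq))
      ... | yes refl | no  _    | yes eq   = ⊥-elim (p≢r (sym eq))
      ... | no  _    | yes refl | yes eq   = ⊥-elim (q≢r (sym eq))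
      ... | yes refl | no  _    | no  _    =
        ≤-trans (+-monoˡ-≤ 1 (⟦⟧≤1 (near p))) (≤-trans (≤-reflexive (sym (at-ends-self p))) (m≤m+n _ _))
      ... | no  _    | yes refl | no  _    =
        ≤-trans (+-monoˡ-≤ 1 (⟦⟧≤1 (near q))) (≤-trans (≤-reflexive (sym (at-ends-self q))) (m≤n+m _ (at-ends p q)))
      ... | no  _    | no  _    | yes refl = ≤-trans (+-monoˡ-≤ 1 (⟦⟧≤1 (near r)))
        (+-mono-≤ (at-ends≥1 p r (Inc⇒touches u p r u∈p u∈r)) (at-ends≥1 q r (Inc⇒touches v q r v∈q v∈r)))
      ... | no  _    | no  _    | no  _    = subst (_≤ at-ends p e + at-ends q e) (sym (+-identityʳ _))
        (≤-trans (⟦∨⟧≤ (touches p e) (touches q e))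
          (+-mono-≤ (⟦∨⟧≤ (incident G (src p) e) _) (⟦∨⟧≤ (incident G (src q) e) _)))

-- Pulling a colouring back from a normal sheet.

module PullBack (G : Multigraph) (cubic : IsCubic G) (H : Handle G) (k : ℕ) where
  open Multigraph G
  open Graph G
  open Colour G cubic
  open Handle H
  open Cover G H k

  -- An edge other than `p` and `q` has both ends in one sheet, so any of its copies meeting sheet
  -- `i` is the copy over `i`.
  over-Inc⇒ : ∀ i x j e → R.Inc (x at i) (e over j) → Inc x e × (p ≢ e → q ≢ e → i ≡ j)
  over-Inc⇒ i x j e inc with R.Inc⇒end (x at i) (e over j) inc
  ... | inj₁ eq = let i≡j , x≡s = combine-injective i x j (src e) (trans eq (src-over j e))
                  in  subst (λ x → Inc x e) (sym x≡s) (Inc-src e) , λ _ _ → i≡j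
  ... | inj₂ eq = let i≡j , x≡t = combine-injective i x (shift e j) (tgt e) (trans eq (tgt-over j e))
                  in  subst (λ x → Inc x e) (sym x≡t) (Inc-tgt e) ,
                      λ p≢e q≢e → trans i≡j (shift-other p≢e q≢e j)

  over-Inc⇐ : ∀ i x e → p ≢ e → q ≢ e → Inc x e → R.Inc (x at i) (e over i)
  over-Inc⇐ i x e p≢e q≢e inc with Inc⇒end x e inc
  ... | inj₁ refl = subst (λ v → R.Inc v (e over i)) (src-over i e) (R.Inc-src (e over i))
  ... | inj₂ refl = subst (λ v → R.Inc v (e over i))
    (trans (tgt-over i e) (cong (tgt e at_) (shift-other p≢e q≢e i))) (R.Inc-tgt (e over i))

  module _ (c : EdgeColoring5 cover) (proper : IsProper cover c) (i : Sheet)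
           (normal : ∀ e → isAbnormal cover c (e over i) ≡ false) where

    c₀ : EdgeColoring5 G
    c₀ e = c (e over i)

    proper₀ : ∀ e f → p ≢ e → q ≢ e → p ≢ f → q ≢ f → e ≢ f → touches e f ≡ true → c₀ e ≢ c₀ f
    proper₀ e f p≢e q≢e p≢f q≢f e≢f t with touches⇒Inc e f t
    ... | v , v∈e , v∈f = proper (e over i) (f over i) (e≢f ∘ combine-injectiveʳ i e i f)
            (v at i , over-Inc⇐ i v e p≢e q≢e v∈e , over-Inc⇐ i v f p≢f q≢f v∈f)

    c₁ c₂ : EdgeColoring5 G
    c₁ = proj₁ (recolour c₀ p)
    c₂ = proj₁ (recolour c₁ q)

    c₁-unchanged : ∀ e → p ≢ e → c₁ e ≡ c₀ e
    c₁-unchanged = proj₁ (proj₂ (recolour c₀ p))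

    c₂-unchanged : ∀ e → q ≢ e → c₂ e ≡ c₁ e
    c₂-unchanged = proj₁ (proj₂ (recolour c₁ q))

    -- The new colour of `p` avoids those of all its neighbours, so `q` is the only exception left;
    -- the second recolouring removes it.
    c₁-proper : ∀ e f → q ≢ e → q ≢ f → e ≢ f → touches e f ≡ true → c₁ e ≢ c₁ f
    c₁-proper e f q≢e q≢f e≢f t eq with p ≟ e | p ≟ f
    ... | yes refl | _        = proj₂ (proj₂ (recolour c₀ p)) f e≢f t eq
    ... | no  _    | yes refl = proj₂ (proj₂ (recolour c₀ p)) e (e≢f ∘ sym) (touches-sym e f t) (sym eq)
    ... | no  p≢e  | no  p≢f  = proper₀ e f p≢e q≢e p≢f q≢f e≢f t
                                  (trans (sym (c₁-unchanged e p≢e)) (trans eq (c₁-unchanged f p≢f)))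

    c₂-proper : IsProper G c₂
    c₂-proper e f e≢f (v , v∈e , v∈f) eq with q ≟ e | q ≟ f
    ... | yes refl | _        = proj₂ (proj₂ (recolour c₁ q)) f e≢f (Inc⇒touches v e f v∈e v∈f) eq
    ... | no  _    | yes refl = proj₂ (proj₂ (recolour c₁ q)) e (e≢f ∘ sym) (Inc⇒touches v f e v∈f v∈e) (sym eq)
    ... | no  q≢e  | no  q≢f  = c₁-proper e f q≢e q≢f e≢f (Inc⇒touches v e f v∈e v∈f)
                                  (trans (sym (c₂-unchanged e q≢e)) (trans eq (c₂-unchanged f q≢f)))

    c₂≡c : ∀ e → p ≢ e → q ≢ e → c₂ e ≡ c (e over i)
    c₂≡c e p≢e q≢e = trans (c₂-unchanged e q≢e) (c₁-unchanged e p≢e)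

    Far : Vertex G → Set
    Far x = ∀ f → Inc x f → p ≢ f × q ≢ f

    -- The edges at such vertices keep the colours of their copies over `i`, and those copies are
    -- exactly the edges of the cover at `x at i` and `y at i`.
    unionSize-far : ∀ x y → Far x → Far y → unionSize G c₂ x y ≡ unionSize cover c (x at i) (y at i)
    unionSize-far x y far-x far-y = count-cong (λ a → ≡true-iff
      (R.seen⇐ c (x at i) (y at i) a ∘ up ∘ seen⇒ c₂ x y a)
      (seen⇐ c₂ x y a ∘ down ∘ R.seen⇒ c (x at i) (y at i) a))
      where
      far : ∀ f → Inc x f ⊎ Inc y f → p ≢ f × q ≢ f
      far f = [ far-x f , far-y f ]′
      up : ∀ {a} → Seen c₂ x y a → R.Seen c (x at i) (y at i) a
      up (f , inc , c₂f≡a) =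
        let p≢f , q≢f = far f inc
        in  f over i , map-⊎ (over-Inc⇐ i x f p≢f q≢f) (over-Inc⇐ i y f p≢f q≢f) inc ,
            trans (sym (c₂≡c f p≢f q≢f)) c₂f≡a
      down-over : ∀ {a} j f → R.Inc (x at i) (f over j) ⊎ R.Inc (y at i) (f over j) →
        c (f over j) ≡ a → Seen c₂ x y a
      down-over j f inc cf≡a =
        let inc′ = map-⊎ (over-Inc⇒ i x j f) (over-Inc⇒ i y j f) inc
            inc₀ = map-⊎ proj₁ proj₁ inc′
            p≢f , q≢f = far f inc₀
            i≡j = [ (λ h → proj₂ h p≢f q≢f) , (λ h → proj₂ h p≢f q≢f) ]′ inc′
        in  f , inc₀ , trans (c₂≡c f p≢f q≢f) (trans (cong (λ j → c (f over j)) i≡j) cf≡a)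
      down : ∀ {a} → R.Seen c (x at i) (y at i) a → Seen c₂ x y a
      down {a} (g , inc , cg≡a) =
        let j , f , f-over-j≡g = combine-surjective {sheets} {m} g
            back = subst (λ g → (R.Inc (x at i) g ⊎ R.Inc (y at i) g) × c g ≡ a) (sym f-over-j≡g) (inc , cg≡a)
        in  down-over j f (proj₁ back) (proj₂ back)

    -- Neither end of `e` lies on `p` or `q`, so the colours around `e` are those around its copy in
    -- the normal sheet.
    far-normal : ∀ e → near H e ≡ false → isAbnormal G c₂ e ≡ false
    far-normal e ¬near = trans (cong (λ s → not (s ≡ᵇ 3) ∧ not (s ≡ᵇ 5)) sizes) (normal e)
      where
      far : ∀ x → Inc x e → Far x
      far x x∈e f x∈f = (λ { refl → true≢false (Inc⇒touches x f e x∈f x∈e) (proj₁ (∨-false (touches p e) _ ¬near)) })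
                    , (λ { refl → true≢false (Inc⇒touches x f e x∈f x∈e) (proj₂ (∨-false (touches p e) _ ¬near)) })
      sizes : unionSize G c₂ (src e) (tgt e) ≡ unionSize cover c (R.src (e over i)) (R.tgt (e over i))
      sizes = trans (unionSize-far (src e) (tgt e) (far (src e) (Inc-src e)) (far (tgt e) (Inc-tgt e)))
        (cong₂ (unionSize cover c) (sym (src-over i e)) (sym (trans (tgt-over i e)
          (cong (tgt e at_) (let p≢e , q≢e = far (src e) (Inc-src e) e (Inc-src e) in shift-other p≢e q≢e i)))))

    numAbnormal≤9 : numAbnormal G c₂ ≤ 9
    numAbnormal≤9 = begin
      numAbnormal G c₂                       ≡⟨ count≡sum (isAbnormal G c₂) ⟩
      sum (λ e → ⟦ isAbnormal G c₂ e ⟧)      ≤⟨ sum-mono abnormal⇒near ⟩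
      sum (λ e → ⟦ near H e ⟧)               ≤⟨ near≤9 H ⟩
      9                                      ∎
      where
      open ≤-Reasoning
      abnormal⇒near : ∀ e → ⟦ isAbnormal G c₂ e ⟧ ≤ ⟦ near H e ⟧
      abnormal⇒near e with near H e in near-e
      ... | true  = ⟦⟧≤1 (isAbnormal G c₂ e)
      ... | false = ≤-reflexive (cong ⟦_⟧ (far-normal e near-e))

  normal-sheet : (c : EdgeColoring5 cover) → numAbnormal cover c < sheets →
    ∃ λ i → ∀ e → isAbnormal cover c (e over i) ≡ false
  normal-sheet c few =
    let i , none = sum<size⇒zero abnormalIn (subst (_< sheets) total few)
    in  i , λ e → Bool.¬-not (λ ab → 1+n≰n (subst₂ _≤_ (cong ⟦_⟧ ab) none (term≤sum (λ e → ⟦ abnormal (e over i) ⟧) e)))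
    where
    abnormal : Edge cover → Bool
    abnormal = isAbnormal cover c
    abnormalIn : Sheet → ℕ
    abnormalIn i = sum (λ e → ⟦ abnormal (e over i) ⟧)
    total : numAbnormal cover c ≡ sum abnormalIn
    total = trans (count≡sum abnormal) (sum-combine {sheets} {m} (λ e → ⟦ abnormal e ⟧))

-- The two implications.

-- All edges get different colours. This settles the graphs that may be too small for a handle.
few-edges : (G : Multigraph) → Multigraph.m G ≤ 5 →
  Σ (EdgeColoring5 G) λ c → IsProper G c × (numAbnormal G c ≤ 9)
few-edges G m≤5 = (λ e → inject≤ e m≤5) , (λ e e′ e≢e′ _ eq → e≢e′ (inject≤-injective m≤5 m≤5 e e′ eq)) , (begin
  count abnormal                ≡⟨ count≡sum abnormal ⟩
  sum (λ e → ⟦ abnormal e ⟧)    ≤⟨ sum-mono (λ e → ⟦⟧≤1 (abnormal e)) ⟩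
  sum {m} (λ _ → 1)             ≡⟨ trans (sum-const m 1) (*-identityʳ m) ⟩
  m                             ≤⟨ m≤5 ⟩
  5                             ≤⟨ m≤m+n 5 4 ⟩
  9                             ∎)
  where
  open ≤-Reasoning
  open Multigraph G
  abnormal : Edge G → Bool
  abnormal = isAbnormal G (λ e → inject≤ e m≤5)

sublinear⇒bounded : StatementB → StatementA
sublinear⇒bounded (f , sublinear , colourings) G cubic cyc4 with Multigraph.m G ≤? 5
... | yes m≤5 = few-edges G m≤5
... | no  m≰5 =
  let c , proper , few = colourings cover (cover-cubic cubic) cover-cyc4
      i , normal = normal-sheet c (≤-<-trans few f<sheets)
  in  c₂ c proper i normal , c₂-proper c proper i normal , numAbnormal≤9 c proper i normal
  where
  open Multigraph G
  5<m : 5 < m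
  5<m = ≰⇒> m≰5
  4≤n : 4 ≤ n
  -- At least six edges and 3n = 2m give 12 ≤ 3n.
  4≤n = *-cancelʳ-≤ 4 n 3 (subst (12 ≤_) (sym (Cubic.handshake G cubic)) (*-monoˡ-≤ 2 5<m))
  H : Handle G
  H = Essential.handle G cubic cyc4 4≤n (fromℕ< (≤-trans (s≤s z≤n) 5<m))
  threshold : ∃ λ N → ∀ n′ → N ≤ n′ → suc n * f n′ ≤ n′
  -- The ratio 1/(n+1) is small enough: if `f (K * n)` were at least `K` for the number `K` of
  -- sheets, then `K * (n + 1) ≤ K * n`.
  threshold = sublinear (suc n) (s≤s z≤n)
  N : ℕ
  N = proj₁ threshold
  -- The cover has `N + 2` sheets, hence at least `N` vertices, which reaches the threshold.
  open Cover G H N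
  open CoverCuts G cubic cyc4 H N
  open PullBack G cubic H N
  f<sheets : f (sheets * n) < sheets
  f<sheets = ≰⇒> λ sheets≤f → 1+n≰n (begin
    suc (sheets * n)               ≤⟨ +-monoˡ-≤ (sheets * n) {1} {sheets} (s≤s z≤n) ⟩
    sheets + sheets * n            ≡⟨ *-suc sheets n ⟨
    sheets * suc n                 ≡⟨ *-comm sheets (suc n) ⟩
    suc n * sheets                 ≤⟨ *-monoʳ-≤ (suc n) sheets≤f ⟩
    suc n * f (sheets * n)         ≤⟨ proj₂ threshold (sheets * n) N≤ ⟩
    sheets * n                     ∎)
    where
    open ≤-Reasoning
    N≤ : N ≤ sheets * n
    N≤ = begin
      N              ≤⟨ m≤n+m N 2 ⟩
      sheets         ≡⟨ *-identityʳ sheets ⟨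
      sheets * 1     ≤⟨ *-monoʳ-≤ sheets (≤-trans (s≤s z≤n) 4≤n) ⟩
      sheets * n     ∎

bounded⇒sublinear : StatementA → StatementB
bounded⇒sublinear colourings =
  -- For the constant 9 the required inequality reads `k * 9 ≤ n`, so `k * 9` itself is the
  -- threshold.
  (λ _ → 9) , (λ k _ → k * 9 , λ _ k*9≤n → k*9≤n) , colourings

theorem4 : (StatementA → StatementB) × (StatementB → StatementA)
theorem4 = bounded⇒sublinear , sublinear⇒bounded
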